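{- Let $q=c/d$ be a rational number with $0<q\leq 1$ ($c,d$ positive integers), let $u=\lfloor d/c\rfloor$ and $A=\frac{\sum_{i=1}^c x^{1+i+\left\lfloor \frac{id}{c}\right\rfloor}}{1-x^{c+d}}$. Then the generating function $M(x)=\sum_{n\geq 1}m_nx^n$, where $m_n$ is the number of meet-irreducible elements of $\mathbb{W}_n^q$, is $$M(x)=\frac{x^{2+u}(x-1)A-(x-1)A^2+x^2}{(x-1)\left(x^{2+u}(1-A)+Ax^{3+u}+(x-1)(x+A-A^2)\right)}.$$
   Context: A $q$-decreasing word of length $n$ is a binary word of length $n$ in which every maximal factor $0^a1^b$ satisfies $a=0$ or $qa>b$; $\mathcal{W}_n^q$ is the set of them and $\mathbb{W}_n^q$ is this set with the componentwise order ($v\leq w$ iff $v_i\leq w_i$ for all $i$), which is a lattice. An element $P$ is meet-irreducible if $P=R\wedge S$ implies $P=R$ or $P=S$.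
   Formalization: Meet-irreducible elements are here required to differ from the top element 1^n (the standard convention); under the literal definition the top would count too and the formula would be off by one for each n (e.g. q=1, n=1: two elements, but coefficient 1). -}

module Defs where

open import Data.Bool using (Bool; true; false) renaming (_≤_ to _≤ᵇ_)
open import Data.Nat using (ℕ; zero; suc; _+_; _*_; _∸_; _<_; _≤_; NonZero)
open import Data.Nat.DivMod using (_/_)
open import Data.Integer using (ℤ; +_) renaming (_+_ to _+ℤ_; _*_ to _*ℤ_; -_ to -ℤ_)
open import Data.List using (List; []; _∷_; _++_; [_]; replicate; length)
open import Data.List.Membership.Propositional using (_∈_)
open import Data.List.Relation.Unary.Unique.Propositional using (Unique)
open import Data.Vec using (Vec; lookup; toList)
open import Data.Fin using (Fin)
open import Data.Product using (Σ; ∃; _×_)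
open import Data.Sum using (_⊎_)
open import Relation.Binary.PropositionalEquality using (_≡_)
open import Relation.Nullary using (¬_)
open import Function.Bundles using (_⇔_)

-- maximality of an occurrence  u ++ 0^a 1^b ++ v  of a factor of the form 0^a 1^b
-- (it cannot be extended to the left, resp. right, keeping the form 0^* 1^*)
LeftMax : ℕ → List Bool → Set
LeftMax a u = u ≡ [] ⊎ (1 ≤ a × ∃ λ u' → u ≡ u' ++ [ true ])

RightMax : ℕ → List Bool → Set
RightMax b v = v ≡ [] ⊎ (1 ≤ b × ∃ λ v' → v ≡ false ∷ v')

-- every maximal factor 0^a 1^b satisfies a = 0 or q a > b  (i.e. d * b < c * a)
QDecList : ℕ → ℕ → List Bool → Set
QDecList c d w = ∀ (u : List Bool) (a b : ℕ) (v : List Bool) →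
  w ≡ u ++ (replicate a false ++ (replicate b true ++ v)) →
  LeftMax a u → RightMax b v → a ≡ 0 ⊎ d * b < c * a

-- words of length n (false = 0, true = 1)
Word : ℕ → Set
Word n = Vec Bool n

QDec : ℕ → ℕ → {n : ℕ} → Word n → Set
QDec c d w = QDecList c d (toList w)

_≤ʷ_ : {n : ℕ} → Word n → Word n → Set
v ≤ʷ w = ∀ i → lookup v i ≤ᵇ lookup w i

IsMeet : ℕ → ℕ → {n : ℕ} → Word n → Word n → Word n → Set
IsMeet c d P R S = P ≤ʷ R × P ≤ʷ S ×
  (∀ T → QDec c d T → T ≤ʷ R → T ≤ʷ S → T ≤ʷ P)

IsTop : ℕ → ℕ → {n : ℕ} → Word n → Set
IsTop c d P = ∀ T → QDec c d T → T ≤ʷ P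

-- meet-irreducible element of 𝕎_n^q (standard convention: not the top element)
MeetIrr : ℕ → ℕ → (n : ℕ) → Word n → Set
MeetIrr c d n P = QDec c d P × ¬ IsTop c d P ×
  (∀ R S → QDec c d R → QDec c d S → IsMeet c d P R S → P ≡ R ⊎ P ≡ S)

HasCard : (n : ℕ) → (Word n → Set) → ℕ → Set
HasCard n Pr k = Σ (List (Word n)) λ L → Unique L × (∀ w → (w ∈ L) ⇔ Pr w) × length L ≡ k

Series : Set
Series = ℕ → ℤ

infixl 6 _⊕_ _⊖_
infixl 7 _⊛_

_⊕_ : Series → Series → Series
(f ⊕ g) k = f k +ℤ g k

negS : Series → Series
negS f k = -ℤ f k

_⊖_ : Series → Series → Series
f ⊖ g = f ⊕ negS g

sumUpTo : (ℕ → ℤ) → ℕ → ℤ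
sumUpTo h zero = h zero
sumUpTo h (suc k) = sumUpTo h k +ℤ h (suc k)

_⊛_ : Series → Series → Series
(f ⊛ g) k = sumUpTo (λ j → f j *ℤ g (k ∸ j)) k

X^ : ℕ → Series
X^ e k with e Data.Nat.≟ k
... | Relation.Nullary.yes _ = + 1
... | Relation.Nullary.no _ = + 0

zeroS : Series
zeroS _ = + 0

sumS : ℕ → (ℕ → Series) → Series
sumS zero F = zeroS
sumS (suc n) F = sumS n F ⊕ F (suc n)

genFun : (ℕ → ℕ) → Series
genFun m zero = + 0
genFun m (suc n) = + m (suc n)

-- the rational function of the theorem, cleared of denominators.
-- With  Nc = Σ_{i=1}^c x^{1+i+⌊id/c⌋}  and  T = 1 - x^{c+d}  we have A = Nc / T.
-- Multiplying numerator and denominator of the formula by T² gives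
--   Num = x^{2+u}(x-1) Nc T - (x-1) Nc² + x² T²
--   Den = (x-1) ( x^{2+u}(T² - Nc T) + Nc T x^{3+u} + (x-1)(x T² + Nc T - Nc²) )
-- and the theorem says  M(x) · Den = Num.

module _ (c d : ℕ) .{{_ : NonZero c}} where
  u : ℕ
  u = d / c

  Nc : Series
  Nc = sumS c (λ i → X^ (1 + i + (i * d) / c))

  Tser : Series
  Tser = X^ 0 ⊖ X^ (c + d)

  xm1 : Series
  xm1 = X^ 1 ⊖ X^ 0

  Num : Series
  Num = ((X^ (2 + u) ⊛ xm1) ⊛ (Nc ⊛ Tser)) ⊖ (xm1 ⊛ (Nc ⊛ Nc)) ⊕ (X^ 2 ⊛ (Tser ⊛ Tser))

  Den : Series
  Den = xm1 ⊛ ( (X^ (2 + u) ⊛ ((Tser ⊛ Tser) ⊖ (Nc ⊛ Tser)))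
              ⊕ ((Nc ⊛ Tser) ⊛ X^ (3 + u))
              ⊕ (xm1 ⊛ ((X^ 1 ⊛ (Tser ⊛ Tser)) ⊕ (Nc ⊛ Tser) ⊖ (Nc ⊛ Nc))) )

{-# OPTIONS --safe #-}

-- Call a block 0^(p+1) 1^b admissible if d b < c (p+1) and c p ≤ d (b+1).  There is exactly one
-- admissible block of each positive length.  Raising a zero of a q-decreasing word and restoring
-- validity fills zero runs from right to left, and the word is meet-irreducible exactly when every
-- such change also raises its first zero.  This means that the word is 1^e followed by a nonempty
-- sequence of admissible blocks in which every non-final block contains a one and every loose block
-- (d (b+1) < c (p+1)) is followed by a block with c p ≤ d b and b ≥ 1.  The loose blocks have the
-- lengths n for which x^(n+1) occurs in A, so splitting off the first block gives linear equations
-- between the generating functions, with coefficients built from A, x and u.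

module Submission where

-- Why the first zero decides: if every valid word strictly above P = 1^e 0⋯ raises that zero, any
-- two of them lie above 1^(e+1) 0⋯0, which is not below P, so P is not their meet. If some suffix
-- can be enlarged while the first zero stays, then filling everything before this suffix with ones
-- is a second way up, and the two enlargements meet in P. Why A has its form: the inequalities
-- confine a loose block with b ones to p = ⌊(b+1)d/c⌋, so its length plus one is 1 + i + ⌊id/c⌋
-- with i = b + 1. Adding d zeros and c ones shifts both sides of every inequality by c d, which
-- gives the denominator 1 - x^(c+d). The hypothesis q ≤ 1 keeps loose blocks from being adjacent,
-- so the equation for chains that follow a loose block involves only the series of all chains.

open import Defs hiding (u)
open import Data.Nat using (ℕ; _≤_; NonZero)
open import Relation.Binary.PropositionalEquality using (_≡_)

import Algebra.Solver.Ring as RingSolver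
import Data.Integer as ℤ
import Data.Integer.Properties as ℤP
import Relation.Binary.PropositionalEquality as ≡
import Relation.Binary.Reasoning.Setoid as SetoidReasoning
open import Algebra.Bundles using (CommutativeRing; RawRing)
open import Algebra.Solver.Ring.AlmostCommutativeRing
  using (fromCommutativeRing; _-Raw-AlmostCommutative⟶_)
open import Data.Integer using (ℤ; +_)
open import Data.Maybe using (Maybe; just; nothing)
open import Level using (Level)
open import Relation.Nullary using (yes; no)

-- Elimination of the auxiliary series

ℤraw : RawRing _ _
ℤraw = CommutativeRing.rawRing ℤP.+-*-commutativeRing

module RationalForm {a ℓ : Level} (R : CommutativeRing a ℓ)
  (ι : ℤraw -Raw-AlmostCommutative⟶ fromCommutativeRing R) where
  open CommutativeRing R
  open _-Raw-AlmostCommutative⟶_ ι using () renaming (⟦_⟧ to ι⟦_⟧)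
  open SetoidReasoning setoid

  coeff≟ : (m n : ℤ) → Maybe (ι⟦ m ⟧ ≈ ι⟦ n ⟧)
  coeff≟ m n with m ℤ.≟ n
  ... | yes ≡.refl = just refl
  ... | no _       = nothing

  open RingSolver ℤraw (fromCommutativeRing R) ι coeff≟ using (Polynomial; solve; con; _:=_; _:+_; _:*_; _:-_; :-_)

  :1 : ∀ {n} → Polynomial n
  :1 = con (+ 1)

  one : Carrier
  one = ι⟦ + 1 ⟧

  -- Dictionary: `U` is x^u, `λ′` marks the loose blocks, `J` is 1/(1-x), `Q` is x^(c+d), and A is
  -- x²λ′ = `N`/`T`. `G` counts all chains, `G′` those allowed after a loose block, `M` the
  -- meet-irreducible words. The parameters from `o` to `x³U` stand for the separate series from
  -- which `Num` and `Den` are built; these agree with products of x only up to the ring's equality.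
  module _ (x U T λ′ J G G′ M N o y x² x²U x³U Q : Carrier)
    (o-def   : o ≈ one)
    (y-def   : y ≈ x - o)
    (x²-def  : x² ≈ x * x)
    (x²U-def : x²U ≈ x * (x * U))
    (x³U-def : x³U ≈ x * x²U)
    (T-def   : T ≈ o - Q)
    (J-rec  : J ≈ one + x * J)
    (G-rec  : G ≈ J + x * ((x * (U * J) - (λ′ - U)) * G + (λ′ - U) * G′))
    (G′-rec : G′ ≈ x * λ′ + x * ((x * λ′) * G))
    (M-rec  : M ≈ x * (M + G))
    (A-rec  : x * (x * λ′) ≈ N + Q * (x * (x * λ′))) where

    N-def : N ≈ (x * (x * λ′)) * T
    N-def = begin
      N                         ≈⟨ solve 2 (λ N B → N := N :+ B :- B) refl N (Q * A) ⟩
      N + Q * A - Q * A         ≈⟨ +-congʳ A-rec ⟨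
      A - Q * A                 ≈⟨ solve 2 (λ A Q → A :- Q :* A := A :* (:1 :- Q)) refl A Q ⟩
      A * (one - Q)             ≈⟨ *-congˡ (+-congʳ o-def) ⟨
      A * (o - Q)               ≈⟨ *-congˡ T-def ⟨
      A * T                     ∎
      where A = x * (x * λ′)

    [1-x]J : (one - x) * J ≈ one
    [1-x]J = begin
      (one - x) * J           ≈⟨ solve 2 (λ x J → (:1 :- x) :* J := J :- x :* J) refl x J ⟩
      J - x * J               ≈⟨ +-congʳ J-rec ⟩
      one + x * J - x * J     ≈⟨ solve 2 (λ x J → :1 :+ x :* J :- x :* J := :1) refl x J ⟩
      one                     ∎

    [x-1]M : M * (x - one) ≈ - (x * G)
    [x-1]M = begin
      M * (x - one)           ≈⟨ solve 2 (λ x M → M :* (x :- :1) := x :* M :- M) refl x M ⟩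
      x * M - M               ≈⟨ +-congˡ (-‿cong M-rec) ⟩
      x * M - x * (M + G)     ≈⟨ solve 3 (λ x M G → x :* M :- x :* (M :+ G) := :- (x :* G)) refl x M G ⟩
      - (x * G)               ∎

    -- Multiplication by 1 - x removes `J`, and substituting `G′-rec` leaves one linear equation in
    -- `G` alone.
    [1-x]G : (one - x) * G ≈ one + x * (x * U * G + (one - x) * ((λ′ - U) * (x * λ′ * (one + x * G) - G)))
    [1-x]G = begin
      (one - x) * G
        ≈⟨ *-congˡ G-rec ⟩
      (one - x) * (J + x * ((x * (U * J) - (λ′ - U)) * G + (λ′ - U) * G′))
        ≈⟨ *-congˡ (+-congˡ (*-congˡ (+-congˡ (*-congˡ G′-rec)))) ⟩
      (one - x) * (J + x * ((x * (U * J) - (λ′ - U)) * G + (λ′ - U) * (x * λ′ + x * ((x * λ′) * G))))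
        ≈⟨ solve 5 (λ x U l J G →
             (:1 :- x) :* (J :+ x :* ((x :* (U :* J) :- (l :- U)) :* G :+ (l :- U) :* (x :* l :+ x :* ((x :* l) :* G))))
             := ((:1 :- x) :* J) :+ x :* (x :* U :* G :* ((:1 :- x) :* J) :+ (:1 :- x) :* ((l :- U) :* (x :* l :* (:1 :+ x :* G) :- G))))
           refl x U λ′ J G ⟩
      (one - x) * J + x * (x * U * G * ((one - x) * J) + W)
        ≈⟨ +-cong [1-x]J (*-congˡ (+-congʳ (*-congˡ [1-x]J))) ⟩
      one + x * (x * U * G * one + W)
        ≈⟨ solve 4 (λ x U G W → :1 :+ x :* (x :* U :* G :* :1 :+ W) := :1 :+ x :* (x :* U :* G :+ W)) refl x U G W ⟩
      one + x * (x * U * G + W) ∎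
      where W = (one - x) * ((λ′ - U) * (x * λ′ * (one + x * G) - G))

    Denominator : (y x²U x³U N : Carrier) → Carrier
    Denominator y x²U x³U N =
      y * (x²U * ((T * T) - (N * T)) + (N * T) * x³U + y * (x * (T * T) + (N * T) - (N * N)))

    Numerator : (y x² x²U N : Carrier) → Carrier
    Numerator y x² x²U N = (x²U * y) * (N * T) - y * (N * N) + x² * (T * T)

    Denominator-cong : ∀ {y y′ x²U x²U′ x³U x³U′ N N′} →
      y ≈ y′ → x²U ≈ x²U′ → x³U ≈ x³U′ → N ≈ N′ →
      Denominator y x²U x³U N ≈ Denominator y′ x²U′ x³U′ N′
    Denominator-cong y≈ p≈ q≈ N≈ = *-cong y≈ (+-cong (+-cong
      (*-cong p≈ (+-congˡ (-‿cong (*-congʳ N≈)))) (*-cong (*-congʳ N≈) q≈))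
      (*-cong y≈ (+-cong (+-congˡ (*-congʳ N≈)) (-‿cong (*-cong N≈ N≈)))))

    Numerator-cong : ∀ {y y′ x² x²′ x²U x²U′ N N′} →
      y ≈ y′ → x² ≈ x²′ → x²U ≈ x²U′ → N ≈ N′ →
      Numerator y x² x²U N ≈ Numerator y′ x²′ x²U′ N′
    Numerator-cong y≈ s≈ p≈ N≈ = +-cong (+-cong (*-cong (*-cong p≈ y≈) (*-congʳ N≈))
      (-‿cong (*-cong y≈ (*-cong N≈ N≈)))) (*-congʳ s≈)

    -- No series is inverted. Up to the factor x²T², -x `D` is the coefficient of `G` in `[1-x]G`.
    -- The term `Z` cancels the part of x `Y` that is free of `G`, so the linear equation turns the
    -- product into x²T²(1 + `Z`), which is the numerator.
    quotient : M * Denominator y x²U x³U N ≈ Numerator y x² x²U N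
    quotient = begin
      M * Denominator y x²U x³U N
        ≈⟨ *-congˡ (Denominator-cong y≈ x²U-def (trans x³U-def (*-congˡ x²U-def)) N-def) ⟩
      M * Denominator (x - one) (x * (x * U)) (x * (x * (x * U))) (A * T)
        ≈⟨ *-assoc M (x - one) _ ⟨
      M * (x - one) * D
        ≈⟨ *-congʳ [x-1]M ⟩
      - (x * G) * D
        ≈⟨ solve 5 (λ x U T l G →
             let N = (x :* (x :* l)) :* T in
             :- (x :* G) :* ((x :* (x :* U)) :* ((T :* T) :- (N :* T))
                       :+ (N :* T) :* (x :* (x :* (x :* U)))
                       :+ (x :- :1) :* (x :* (T :* T) :+ (N :* T) :- (N :* N)))
             := x :* x :* (T :* T) :* ((:1 :- x) :* G :- x :* (x :* U :* G :+ (:1 :- x) :* ((l :- U) :* (x :* l :* (:1 :+ x :* G) :- G)))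
                     :+ (:1 :- x) :* (l :- U) :* (x :* x :* l)))
           refl x U T λ′ G ⟩
      x * x * (T * T) * ((one - x) * G - x * Y + Z)
        ≈⟨ *-congˡ (+-congʳ (+-congʳ [1-x]G)) ⟩
      x * x * (T * T) * ((one + x * Y) - x * Y + Z)
        ≈⟨ solve 4 (λ x T Y Z → x :* x :* (T :* T) :* ((:1 :+ x :* Y) :- x :* Y :+ Z) := x :* x :* (T :* T) :* (:1 :+ Z)) refl x T Y Z ⟩
      x * x * (T * T) * (one + Z)
        ≈⟨ solve 4 (λ x U T l → let N = (x :* (x :* l)) :* T in
            x :* x :* (T :* T) :* (:1 :+ (:1 :- x) :* (l :- U) :* (x :* x :* l))
            := ((x :* (x :* U)) :* (x :- :1)) :* (N :* T) :- (x :- :1) :* (N :* N) :+ (x :* x) :* (T :* T)) refl x U T λ′ ⟩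
      Numerator (x - one) (x * x) (x * (x * U)) (A * T)
        ≈⟨ Numerator-cong y≈ x²-def x²U-def N-def ⟨
      Numerator y x² x²U N ∎
      where
      y≈ : y ≈ x - one
      y≈ = trans y-def (+-congˡ (-‿cong o-def))
      A = x * (x * λ′)
      D = (x * (x * U)) * ((T * T) - ((A * T) * T)) + ((A * T) * T) * (x * (x * (x * U)))
          + (x - one) * (x * (T * T) + ((A * T) * T) - ((A * T) * (A * T)))
      Y = x * U * G + (one - x) * ((λ′ - U) * (x * λ′ * (one + x * G) - G))
      Z = (one - x) * (λ′ - U) * (x * x * λ′)

import Data.Bool.Properties as BoolP
import Data.List.Properties as ListP
import Data.List.Relation.Unary.Unique.Propositional.Properties as UniqueP
import Data.Nat.Properties as ℕP
import Data.Nat.Solver as ℕSolver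
import Data.Vec.Properties as VecP
open import Data.Bool using (Bool; true; false; if_then_else_; T; _∧_; not; b≤b; f≤t) renaming (_≤_ to _≤ᵇ_)
open import Data.Fin using (zero; suc)
open import Data.Integer using () renaming (_+_ to _+ℤ_; _*_ to _*ℤ_; -_ to -ℤ_)
open import Data.Integer.Solver using (module +-*-Solver)
open import Data.List using (List; []; _∷_; _++_; [_]; replicate; length; map)
open import Data.List.Membership.Propositional using (_∈_)
open import Data.List.Membership.Propositional.Properties using (∈-++⁺ˡ; ∈-++⁺ʳ; ∈-++⁻; ∈-map⁺; ∈-map⁻)
open import Data.List.Membership.Propositional.Properties.WithK using (unique∧set⇒bag)
open import Data.List.Relation.Binary.BagAndSetEquality using (∼bag⇒↭)
open import Data.List.Relation.Binary.Permutation.Propositional.Properties using (↭-length)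
open import Data.List.Relation.Binary.Pointwise as Pw using (Pointwise; []; _∷_)
open import Data.List.Relation.Unary.All using ([])
open import Data.List.Relation.Unary.AllPairs using ([]; _∷_)
open import Data.List.Relation.Unary.Any using (here)
open import Data.List.Relation.Unary.Unique.Propositional using (Unique)
open import Data.Nat using (zero; suc; _+_; _*_; _∸_; _<_; _<ᵇ_; z≤n; s≤s; >-nonZero⁻¹)
open import Data.Nat.DivMod using (_/_; m≡m%n+[m/n]*n; m%n<n; /-monoˡ-≤; m/n*n≤m; m<n*o⇒m/o<n; m*n/n≡m)
open import Data.Product using (∃; ∃₂; _×_; _,_; proj₁; proj₂)
open import Data.Sum using (_⊎_; inj₁; inj₂)
open import Data.Unit using (⊤; tt)
open import Data.Vec using (toList; fromList; []; _∷_)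
open import Function.Bundles using (mk⇔; Equivalence)
open import Relation.Binary.Definitions using (tri<; tri≈; tri>)
open import Relation.Binary.PropositionalEquality
  using (_≢_; refl; sym; trans; cong; cong₂; subst; subst₂; module ≡-Reasoning)
open import Relation.Nullary using (contradiction; ¬_)

-- The ring of formal power series

infix 4 _≗ˢ_
_≗ˢ_ : Series → Series → Set
f ≗ˢ g = ∀ k → f k ≡ g k

tailS : Series → Series
tailS f k = f (suc k)

sumUpTo-cong : ∀ {f g} n → (∀ j → j ≤ n → f j ≡ g j) → sumUpTo f n ≡ sumUpTo g n
sumUpTo-cong zero    eq = eq 0 z≤n
sumUpTo-cong (suc n) eq = cong₂ _+ℤ_ (sumUpTo-cong n (λ j j≤n → eq j (ℕP.m≤n⇒m≤1+n j≤n))) (eq (suc n) ℕP.≤-refl)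

sumUpTo-head : ∀ f n → sumUpTo f (suc n) ≡ f 0 +ℤ sumUpTo (λ j → f (suc j)) n
sumUpTo-head f zero    = refl
sumUpTo-head f (suc n) = trans (cong (_+ℤ f (suc (suc n))) (sumUpTo-head f n)) (ℤP.+-assoc (f 0) _ _)

⊛-head : ∀ f g n → (f ⊛ g) (suc n) ≡ f 0 *ℤ g (suc n) +ℤ (tailS f ⊛ g) n
⊛-head f g n = sumUpTo-head (λ j → f j *ℤ g (suc n ∸ j)) n

⊛-last : ∀ f g n → (f ⊛ g) (suc n) ≡ (f ⊛ tailS g) n +ℤ f (suc n) *ℤ g 0
⊛-last f g n = cong₂ _+ℤ_
  (sumUpTo-cong n (λ j j≤n → cong (λ i → f j *ℤ g i) (ℕP.+-∸-assoc 1 j≤n)))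
  (cong (λ i → f (suc n) *ℤ g i) (ℕP.n∸n≡0 n))

⊛-cong : ∀ {f f′ g g′} → f ≗ˢ f′ → g ≗ˢ g′ → f ⊛ g ≗ˢ f′ ⊛ g′
⊛-cong f≗ g≗ n = sumUpTo-cong n (λ j _ → cong₂ _*ℤ_ (f≗ j) (g≗ (n ∸ j)))

-- Peeling off the first summand on one side corresponds to peeling off the last summand on the
-- other.
⊛-comm : ∀ f g → f ⊛ g ≗ˢ g ⊛ f
⊛-comm f g zero    = ℤP.*-comm (f 0) (g 0)
⊛-comm f g (suc n) = begin
  (f ⊛ g) (suc n)                          ≡⟨ ⊛-head f g n ⟩
  f 0 *ℤ g (suc n) +ℤ (tailS f ⊛ g) n      ≡⟨ cong₂ _+ℤ_ (ℤP.*-comm (f 0) _) (⊛-comm (tailS f) g n) ⟩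
  g (suc n) *ℤ f 0 +ℤ (g ⊛ tailS f) n      ≡⟨ ℤP.+-comm (g (suc n) *ℤ f 0) _ ⟩
  (g ⊛ tailS f) n +ℤ g (suc n) *ℤ f 0      ≡⟨ ⊛-last g f n ⟨
  (g ⊛ f) (suc n)                          ∎
  where open ≡-Reasoning

⊛-distribʳ : ∀ h f g → (f ⊕ g) ⊛ h ≗ˢ (f ⊛ h) ⊕ (g ⊛ h)
⊛-distribʳ h f g zero    = ℤP.*-distribʳ-+ (h 0) (f 0) (g 0)
⊛-distribʳ h f g (suc n) = begin
  ((f ⊕ g) ⊛ h) (suc n)                                              ≡⟨ ⊛-head (f ⊕ g) h n ⟩
  (f 0 +ℤ g 0) *ℤ h (suc n) +ℤ ((tailS f ⊕ tailS g) ⊛ h) n           ≡⟨ cong ((f 0 +ℤ g 0) *ℤ h (suc n) +ℤ_) (⊛-distribʳ h (tailS f) (tailS g) n) ⟩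
  (f 0 +ℤ g 0) *ℤ h (suc n) +ℤ ((tailS f ⊛ h) n +ℤ (tailS g ⊛ h) n)  ≡⟨ regroup (f 0) (g 0) (h (suc n)) _ _ ⟩
  (f 0 *ℤ h (suc n) +ℤ (tailS f ⊛ h) n) +ℤ (g 0 *ℤ h (suc n) +ℤ (tailS g ⊛ h) n) ≡⟨ cong₂ _+ℤ_ (⊛-head f h n) (⊛-head g h n) ⟨
  ((f ⊛ h) ⊕ (g ⊛ h)) (suc n)                                        ∎
  where
  open ≡-Reasoning
  regroup : ∀ a b x y z → (a +ℤ b) *ℤ x +ℤ (y +ℤ z) ≡ (a *ℤ x +ℤ y) +ℤ (b *ℤ x +ℤ z)
  regroup = +-*-Solver.solve 5 (λ a b x y z → (a :+ b) :* x :+ (y :+ z) := (a :* x :+ y) :+ (b :* x :+ z)) refl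
    where open +-*-Solver

constS : ℤ → Series
constS z zero    = z
constS z (suc _) = + 0

zero-⊛ : ∀ f → zeroS ⊛ f ≗ˢ zeroS
zero-⊛ f zero    = refl
zero-⊛ f (suc n) = trans (⊛-head zeroS f n) (trans (ℤP.+-identityˡ _) (zero-⊛ f n))

const-⊛ : ∀ z f k → (constS z ⊛ f) k ≡ z *ℤ f k
const-⊛ z f zero    = refl
const-⊛ z f (suc n) = trans (⊛-head (constS z) f n)
  (trans (cong (z *ℤ f (suc n) +ℤ_) (zero-⊛ f n)) (ℤP.+-identityʳ _))

⊛-assoc : ∀ f g h → (f ⊛ g) ⊛ h ≗ˢ f ⊛ (g ⊛ h)
⊛-assoc f g h zero    = ℤP.*-assoc (f 0) (g 0) (h 0)
⊛-assoc f g h (suc n) = begin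
  ((f ⊛ g) ⊛ h) (suc n)
    ≡⟨ ⊛-head (f ⊛ g) h n ⟩
  (f 0 *ℤ g 0) *ℤ h (suc n) +ℤ (tailS (f ⊛ g) ⊛ h) n
    ≡⟨ cong ((f 0 *ℤ g 0) *ℤ h (suc n) +ℤ_) tail-step ⟩
  (f 0 *ℤ g 0) *ℤ h (suc n) +ℤ (f 0 *ℤ (tailS g ⊛ h) n +ℤ (tailS f ⊛ (g ⊛ h)) n)
    ≡⟨ regroup (f 0) (g 0) (h (suc n)) _ _ ⟩
  f 0 *ℤ (g 0 *ℤ h (suc n) +ℤ (tailS g ⊛ h) n) +ℤ (tailS f ⊛ (g ⊛ h)) n
    ≡⟨ cong (λ z → f 0 *ℤ z +ℤ (tailS f ⊛ (g ⊛ h)) n) (⊛-head g h n) ⟨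
  f 0 *ℤ (g ⊛ h) (suc n) +ℤ (tailS f ⊛ (g ⊛ h)) n
    ≡⟨ ⊛-head f (g ⊛ h) n ⟨
  (f ⊛ (g ⊛ h)) (suc n) ∎
  where
  open ≡-Reasoning
  regroup : ∀ a b x y z → (a *ℤ b) *ℤ x +ℤ (a *ℤ y +ℤ z) ≡ a *ℤ (b *ℤ x +ℤ y) +ℤ z
  regroup = +-*-Solver.solve 5 (λ a b x y z → (a :* b) :* x :+ (a :* y :+ z) := a :* (b :* x :+ y) :+ z) refl
    where open +-*-Solver
  -- The tail obeys a product rule: `tailS (f ⊛ g)` is `f 0` times `tailS g` plus `tailS f ⊛ g`.
  tail-step : (tailS (f ⊛ g) ⊛ h) n ≡ f 0 *ℤ (tailS g ⊛ h) n +ℤ (tailS f ⊛ (g ⊛ h)) n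
  tail-step = begin
    (tailS (f ⊛ g) ⊛ h) n
      ≡⟨ ⊛-cong {g = h} (λ k → trans (⊛-head f g k) (cong (_+ℤ (tailS f ⊛ g) k) (sym (const-⊛ (f 0) (tailS g) k)))) (λ _ → refl) n ⟩
    (((constS (f 0) ⊛ tailS g) ⊕ (tailS f ⊛ g)) ⊛ h) n
      ≡⟨ ⊛-distribʳ h (constS (f 0) ⊛ tailS g) (tailS f ⊛ g) n ⟩
    ((constS (f 0) ⊛ tailS g) ⊛ h) n +ℤ ((tailS f ⊛ g) ⊛ h) n
      ≡⟨ cong₂ _+ℤ_ (scalar n) (⊛-assoc (tailS f) g h n) ⟩
    f 0 *ℤ (tailS g ⊛ h) n +ℤ (tailS f ⊛ (g ⊛ h)) n ∎
    where
    scalar-sum : ∀ z (p : ℕ → ℤ) n → sumUpTo (λ j → z *ℤ p j) n ≡ z *ℤ sumUpTo p n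
    scalar-sum z p zero    = refl
    scalar-sum z p (suc n) = trans (cong (_+ℤ z *ℤ p (suc n)) (scalar-sum z p n)) (sym (ℤP.*-distribˡ-+ z _ _))
    scalar : ∀ k → ((constS (f 0) ⊛ tailS g) ⊛ h) k ≡ f 0 *ℤ (tailS g ⊛ h) k
    scalar k = trans
      (sumUpTo-cong k (λ j _ → trans (cong (_*ℤ h (k ∸ j)) (const-⊛ (f 0) (tailS g) j)) (ℤP.*-assoc (f 0) _ _)))
      (scalar-sum (f 0) (λ j → tailS g j *ℤ h (k ∸ j)) k)

⊛-identityˡ : ∀ f → constS (+ 1) ⊛ f ≗ˢ f
⊛-identityˡ f k = trans (const-⊛ (+ 1) f k) (ℤP.*-identityˡ (f k))

seriesRing : CommutativeRing _ _
seriesRing = record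
  { Carrier = Series ; _≈_ = _≗ˢ_ ; _+_ = _⊕_ ; _*_ = _⊛_ ; -_ = negS ; 0# = zeroS ; 1# = constS (+ 1)
  ; isCommutativeRing = record
    { isRing = record
      { +-isAbelianGroup = record
        { isGroup = record
          { isMonoid = record
            { isSemigroup = record
              { isMagma = record
                { isEquivalence = record { refl = λ _ → refl ; sym = λ p k → sym (p k) ; trans = λ p q k → trans (p k) (q k) }
                ; ∙-cong = λ p q k → cong₂ _+ℤ_ (p k) (q k) }
              ; assoc = λ f g h k → ℤP.+-assoc (f k) (g k) (h k) }
            ; identity = (λ f k → ℤP.+-identityˡ (f k)) , (λ f k → ℤP.+-identityʳ (f k)) }
          ; inverse = (λ f k → ℤP.+-inverseˡ (f k)) , (λ f k → ℤP.+-inverseʳ (f k))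
          ; ⁻¹-cong = λ p k → cong -ℤ_ (p k) }
        ; comm = λ f g k → ℤP.+-comm (f k) (g k) }
      ; *-cong = ⊛-cong
      ; *-assoc = ⊛-assoc
      ; *-identity = ⊛-identityˡ , (λ f k → trans (⊛-comm f (constS (+ 1)) k) (⊛-identityˡ f k))
      ; distrib = (λ h f g k → trans (⊛-comm h (f ⊕ g) k)
                      (trans (⊛-distribʳ h f g k) (cong₂ _+ℤ_ (⊛-comm f h k) (⊛-comm g h k))))
                , ⊛-distribʳ }
    ; *-comm = ⊛-comm } }

constS-morphism : ℤraw -Raw-AlmostCommutative⟶ fromCommutativeRing seriesRing
constS-morphism = record
  { ⟦_⟧    = constS
  ; +-homo = λ { _ _ zero → refl ; _ _ (suc _) → refl }
  ; *-homo = λ { a b zero → refl ; a b (suc k) → sym (trans (const-⊛ a (constS b) (suc k)) (ℤP.*-zeroʳ a)) }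
  ; -‿homo = λ { _ zero → refl ; _ (suc _) → refl }
  ; 0-homo = λ { zero → refl ; (suc _) → refl }
  ; 1-homo = λ _ → refl }

X^-suc : ∀ e k → X^ (suc e) (suc k) ≡ X^ e k
X^-suc e k with suc e Data.Nat.≟ suc k | e Data.Nat.≟ k
... | yes _   | yes _  = refl
... | no _    | no _   = refl
... | yes p   | no e≢k = contradiction (ℕP.suc-injective p) e≢k
... | no e≢k  | yes p  = contradiction (cong suc p) e≢k

X^0≗1 : X^ 0 ≗ˢ constS (+ 1)
X^0≗1 zero    = refl
X^0≗1 (suc _) = refl

X⊛-suc : ∀ f k → (X^ 1 ⊛ f) (suc k) ≡ f k
X⊛-suc f k = trans (⊛-head (X^ 1) f k) (trans (ℤP.+-identityˡ _)
  (trans (⊛-cong {g = f} (λ j → trans (X^-suc 0 j) (X^0≗1 j)) (λ _ → refl) k) (⊛-identityˡ f k)))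

X^suc≗X⊛X^ : ∀ e → X^ (suc e) ≗ˢ X^ 1 ⊛ X^ e
X^suc≗X⊛X^ e zero    = refl
X^suc≗X⊛X^ e (suc k) = trans (X^-suc e k) (sym (X⊛-suc (X^ e) k))

*≤⇒≤/ : ∀ m n o .{{_ : NonZero n}} → m * n ≤ o → m ≤ o / n
*≤⇒≤/ m n o le = subst (_≤ o / n) (m*n/n≡m m n) (/-monoˡ-≤ n le)

bit : Bool → ℤ
bit true  = + 1
bit false = + 0

ones : Series
ones _ = + 1

X^-≡ : ∀ {e k} → e ≡ k → X^ e k ≡ + 1
X^-≡ {e} {k} eq with e Data.Nat.≟ k
... | yes _ = refl
... | no ne = contradiction eq ne

X^-≢ : ∀ {e k} → e ≢ k → X^ e k ≡ + 0
X^-≢ {e} {k} ne with e Data.Nat.≟ k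
... | yes eq = contradiction eq ne
... | no _ = refl

X^⊛-< : ∀ e f {k} → k < e → (X^ e ⊛ f) k ≡ + 0
X^⊛-< (suc e) f {k} k<e = trans (trans (⊛-cong {g = f} (X^suc≗X⊛X^ e) (λ _ → refl) k) (⊛-assoc (X^ 1) (X^ e) f k)) (step k k<e)
  where
  step : ∀ k → k < suc e → (X^ 1 ⊛ (X^ e ⊛ f)) k ≡ + 0
  step zero    _         = refl
  step (suc k) (s≤s k<e) = trans (X⊛-suc (X^ e ⊛ f) k) (X^⊛-< e f k<e)

X^⊛-+ : ∀ e f k → (X^ e ⊛ f) (e + k) ≡ f k
X^⊛-+ zero    f k = trans (⊛-cong {g = f} X^0≗1 (λ _ → refl) k) (⊛-identityˡ f k)
X^⊛-+ (suc e) f k = trans (trans (⊛-cong {g = f} (X^suc≗X⊛X^ e) (λ _ → refl) (suc e + k)) (⊛-assoc (X^ 1) (X^ e) f (suc e + k)))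
  (trans (X⊛-suc (X^ e ⊛ f) (e + k)) (X^⊛-+ e f k))

-- Binary words

infix 4 _⊑_
_⊑_ : List Bool → List Bool → Set
_⊑_ = Pointwise _≤ᵇ_

⊑-refl : ∀ {x} → x ⊑ x
⊑-refl = Pw.refl b≤b

0^ 1^ : ℕ → List Bool
0^ n = replicate n false
1^ n = replicate n true

block : ℕ → ℕ → List Bool
block p b = 0^ (suc p) ++ 1^ b

replicate-shift : ∀ {A : Set} n (x : A) w → replicate n x ++ x ∷ w ≡ x ∷ replicate n x ++ w
replicate-shift zero    x w = refl
replicate-shift (suc n) x w = cong (x ∷_) (replicate-shift n x w)

replicate-+ : ∀ {A : Set} m n (x : A) w → replicate (m + n) x ++ w ≡ replicate m x ++ replicate n x ++ w
replicate-+ zero    n x w = refl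
replicate-+ (suc m) n x w = cong (x ∷_) (replicate-+ m n x w)

block-++ : ∀ p b w → block p b ++ w ≡ 0^ (suc p) ++ 1^ b ++ w
block-++ p b w = ListP.++-assoc (0^ (suc p)) (1^ b) w

block-true : ∀ p b w → block p b ++ true ∷ w ≡ block p (suc b) ++ w
block-true p b w = trans (block-++ p b (true ∷ w))
  (trans (cong (0^ (suc p) ++_) (replicate-shift b true w)) (sym (block-++ p (suc b) w)))


ones-above : ∀ b {w y} → 1^ b ++ w ⊑ y → ∃ λ y′ → y ≡ 1^ b ++ y′ × w ⊑ y′
ones-above zero    le          = _ , refl , le
ones-above (suc b) (b≤b ∷ le) with ones-above b le
... | y′ , refl , le′ = y′ , refl , le′

firstOne : ∀ p {w y} → 0^ p ++ w ⊑ y →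
  (∃ λ y′ → y ≡ 0^ p ++ y′ × w ⊑ y′)
  ⊎ (∃₂ λ s t → ∃ λ x → suc s + t ≡ p × y ≡ 0^ s ++ true ∷ x × 0^ t ++ w ⊑ x)
firstOne zero    le         = inj₁ (_ , refl , le)
firstOne (suc p) (f≤t ∷ le) = inj₂ (0 , p , _ , refl , refl , le)
firstOne (suc p) (b≤b ∷ le) with firstOne p le
... | inj₁ (y′ , refl , le′)               = inj₁ (y′ , refl , le′)
... | inj₂ (s , t , x , eq , refl , le′) = inj₂ (suc s , t , x , cong suc eq , refl , le′)

++-below : ∀ x {y z} → x ++ y ⊑ z → ∃₂ λ z₁ z₂ → z ≡ z₁ ++ z₂ × length z₁ ≡ length x × y ⊑ z₂
++-below []      le       = [] , _ , refl , refl , le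
++-below (_ ∷ x) (_ ∷ le) with ++-below x le
... | z₁ , z₂ , refl , eq , le′ = _ ∷ z₁ , z₂ , refl , cong suc eq , le′

lastZero : ∀ x → x ≡ 1^ (length x)
  ⊎ (∃ λ u → ∃₂ λ z o → x ≡ u ++ 0^ (suc z) ++ 1^ o × LeftMax (suc z) u × suc z ≤ length x)
lastZero [] = inj₁ refl
lastZero (h ∷ x) with lastZero x
lastZero (true  ∷ x) | inj₁ eq = inj₁ (cong (true ∷_) eq)
lastZero (false ∷ x) | inj₁ eq = inj₂ ([] , 0 , length x , cong (false ∷_) eq , inj₁ refl , s≤s z≤n)
lastZero (true  ∷ _) | inj₂ (.[] , z , o , refl , inj₁ refl , le) =
  inj₂ ([ true ] , z , o , refl , inj₂ (s≤s z≤n , [] , refl) , ℕP.m≤n⇒m≤1+n le)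
lastZero (false ∷ _) | inj₂ (.[] , z , o , refl , inj₁ refl , le) =
  inj₂ ([] , suc z , o , refl , inj₁ refl , s≤s le)
lastZero (h ∷ _) | inj₂ (._ , z , o , refl , inj₂ (1≤z , u′ , refl) , le) =
  inj₂ (h ∷ u′ ++ [ true ] , z , o , refl , inj₂ (1≤z , h ∷ u′ , refl) , ℕP.m≤n⇒m≤1+n le)

Stop : List Bool → Set
Stop v = v ≡ [] ⊎ ∃ λ v′ → v ≡ false ∷ v′

RightMax⇒Stop : ∀ b {v} → RightMax b v → Stop v
RightMax⇒Stop b (inj₁ eq)       = inj₁ eq
RightMax⇒Stop b (inj₂ (_ , st)) = inj₂ st

Stop⇒RightMax : ∀ b {v} → Stop v → RightMax (suc b) v
Stop⇒RightMax b (inj₁ eq) = inj₁ eq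
Stop⇒RightMax b (inj₂ st) = inj₂ (s≤s z≤n , st)

leadingOnes : ∀ v → ∃₂ λ k v′ → v ≡ 1^ k ++ v′ × Stop v′
leadingOnes []          = 0 , [] , refl , inj₁ refl
leadingOnes (false ∷ v) = 0 , false ∷ v , refl , inj₂ (v , refl)
leadingOnes (true ∷ v) with leadingOnes v
... | k , v′ , refl , st = suc k , v′ , refl , st

ones-≤ : ∀ b b′ {w v} → Stop w → 1^ b ++ w ≡ 1^ b′ ++ v → b′ ≤ b
ones-≤ b       zero     st eq = z≤n
ones-≤ zero    (suc b′) (inj₁ refl) ()
ones-≤ zero    (suc b′) (inj₂ (_ , refl)) ()
ones-≤ (suc b) (suc b′) st eq = s≤s (ones-≤ b b′ st (ListP.∷-injectiveʳ eq))

-- The first reading is maximal, so a second one with another number of zeros must stop inside the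
-- zero run, where it can take no ones.
parse-≤ : ∀ p a b b′ {w v} → RightMax b w → 0^ p ++ 1^ b ++ w ≡ 0^ a ++ 1^ b′ ++ v →
  (p ≡ a × b′ ≤ b) ⊎ b′ ≡ 0
parse-≤ zero    zero    b b′ rm eq = inj₁ (refl , ones-≤ b b′ (RightMax⇒Stop b rm) eq)
parse-≤ zero    (suc a) zero b′ (inj₁ refl) ()
parse-≤ zero    (suc a) zero b′ (inj₂ (() , _)) eq
parse-≤ zero    (suc a) (suc b) b′ rm ()
parse-≤ (suc p) zero    b zero rm eq = inj₂ refl
parse-≤ (suc p) zero    b (suc _) rm ()
parse-≤ (suc p) (suc a) b b′ rm eq with parse-≤ p a b b′ rm (ListP.∷-injectiveʳ eq)
... | inj₁ (refl , le) = inj₁ (refl , le)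
... | inj₂ eq′ = inj₂ eq′

parse-unique : ∀ p a b b′ {w v} → RightMax b w → RightMax b′ v →
  block p b ++ w ≡ block a b′ ++ v → p ≡ a × b ≡ b′
parse-unique p a b b′ {w} {v} rm rm′ eq = go (parse-≤ (suc p) (suc a) b b′ rm eq′) (parse-≤ (suc a) (suc p) b′ b rm′ (sym eq′))
  where
  eq′ : 0^ (suc p) ++ 1^ b ++ w ≡ 0^ (suc a) ++ 1^ b′ ++ v
  eq′ = trans (sym (block-++ p b w)) (trans eq (block-++ a b′ v))
  zeros : ∀ p a → RightMax 0 w → RightMax 0 v → 0^ p ++ w ≡ 0^ a ++ v → p ≡ a
  zeros p a (inj₁ refl) (inj₁ refl) eq = trans (sym (ListP.length-replicate p))
    (trans (cong length (trans (sym (ListP.++-identityʳ (0^ p))) (trans eq (ListP.++-identityʳ (0^ a))))) (ListP.length-replicate a))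
  zeros p a (inj₂ (() , _)) _ eq
  zeros p a (inj₁ _) (inj₂ (() , _)) eq
  go : (suc p ≡ suc a × b′ ≤ b) ⊎ b′ ≡ 0 → (suc a ≡ suc p × b ≤ b′) ⊎ b ≡ 0 → p ≡ a × b ≡ b′
  go (inj₁ (refl , le)) (inj₁ (_ , ge)) = refl , ℕP.≤-antisym ge le
  go (inj₁ (refl , le)) (inj₂ refl)     = refl , sym (ℕP.n≤0⇒n≡0 le)
  go (inj₂ refl) (inj₁ (refl , ge))     = refl , ℕP.n≤0⇒n≡0 ge
  go (inj₂ refl) (inj₂ refl)            = ℕP.suc-injective (zeros (suc p) (suc a) rm rm′ eq′) , refl

-- Maximality allows b = 0 only in the final block, so no zero run is cut in two.
data Runs : List Bool → Set where
  nil : Runs []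
  run : ∀ p b {v} → RightMax b v → Runs v → Runs (block p b ++ v)

runs : ∀ l → ∃₂ λ e v → l ≡ 1^ e ++ v × Runs v × Stop v
runs [] = 0 , [] , refl , nil , inj₁ refl
runs (true ∷ l) with runs l
... | e , v , refl , rs , st = suc e , v , refl , rs , st
runs (false ∷ l) with runs l
... | suc e , v , refl , rs , st = 0 , _ , refl , run 0 (suc e) (Stop⇒RightMax e st) rs , inj₂ (_ , refl)
... | zero  , _ , refl , nil , st = 0 , _ , refl , run 0 0 (inj₁ refl) nil , inj₂ (_ , refl)
... | zero  , _ , refl , run p b rm rs , st = 0 , _ , refl , run (suc p) b rm rs , inj₂ (_ , refl)

≤ʷ⇒⊑ : ∀ {n} (v w : Word n) → v ≤ʷ w → toList v ⊑ toList w
≤ʷ⇒⊑ []      []      le = []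
≤ʷ⇒⊑ (_ ∷ v) (_ ∷ w) le = le zero ∷ ≤ʷ⇒⊑ v w (λ i → le (suc i))

⊑⇒≤ʷ : ∀ {n} (v w : Word n) → toList v ⊑ toList w → v ≤ʷ w
⊑⇒≤ʷ (_ ∷ v) (_ ∷ w) (x≤y ∷ le) zero    = x≤y
⊑⇒≤ʷ (_ ∷ v) (_ ∷ w) (x≤y ∷ le) (suc i) = ⊑⇒≤ʷ v w le i

toList-inj : ∀ {n} {v w : Word n} → toList v ≡ toList w → v ≡ w
toList-inj {v = v} {w} eq = trans (sym (VecP.cast-is-id refl v)) (VecP.toList-injective refl v w eq)

word : ∀ {n} l → length l ≡ n → ∃ λ (v : Word n) → toList v ≡ l
word l refl = fromList l , VecP.toList∘fromList l

⊑-1^ : ∀ x → x ⊑ 1^ (length x)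
⊑-1^ []      = []
⊑-1^ (h ∷ x) = BoolP.≤-maximum h ∷ ⊑-1^ x

0^-⊑ : ∀ x → 0^ (length x) ⊑ x
0^-⊑ []      = []
0^-⊑ (h ∷ x) = BoolP.≤-minimum h ∷ 0^-⊑ x

1^-⋢ : ∀ k e {w} → ¬ 1^ k ⊑ 1^ e ++ false ∷ w
1^-⋢ zero    zero    ()
1^-⋢ zero    (suc e) ()
1^-⋢ (suc k) zero    (() ∷ _)
1^-⋢ (suc k) (suc e) (_ ∷ le) = 1^-⋢ k e le

true-⋢ : ∀ e {x w} → ¬ 1^ e ++ true ∷ x ⊑ 1^ e ++ false ∷ w
true-⋢ zero    (() ∷ _)
true-⋢ (suc e) (_ ∷ le) = true-⋢ e le

-- The greatest-lower-bound half of a meet: the second word bounds the prefix and the first word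
-- bounds the rest.
glue-⊑ : ∀ pre {x y z} → x ⊑ 1^ (length pre) ++ y → x ⊑ pre ++ z → x ⊑ pre ++ y
glue-⊑ []        le₁        le₂        = le₁
glue-⊑ (h ∷ pre) (_ ∷ le₁) (h≤ ∷ le₂) = h≤ ∷ glue-⊑ pre le₁ le₂

when : ∀ {A : Set} → Bool → List A → List A
when b xs = if b then xs else []

∈-when : ∀ {A : Set} b {x : A} {xs} → x ∈ when b xs → b ≡ true × x ∈ xs
∈-when true x∈ = refl , x∈

Unique-when : ∀ {A : Set} b {xs : List A} → Unique xs → Unique (when b xs)
Unique-when true  u = u
Unique-when false u = []

module QDecreasing (c d : ℕ) .{{_ : NonZero c}} (c≤d : c ≤ d) where

  1≤c : 1 ≤ c
  1≤c = >-nonZero⁻¹ c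

  -- Admissible blocks


  -- The first inequality makes 0^(p+1) 1^b valid. For p ≥ 1 the second one says that 0^p 1^(b+1),
  -- the block with its last zero raised, is invalid; for p = 0 it is trivial, the only zero being
  -- the first.
  Admissible : ℕ × ℕ → Set
  Admissible (p , b) = d * b < c * suc p × c * p ≤ d * suc b

  isLoose : ℕ × ℕ → Bool
  isLoose (p , b) = d * suc b <ᵇ c * suc p

  -- bl i = (p , b) encodes the admissible block 0^(p+1) 1^b of length i + 1.
  bl : ℕ → ℕ × ℕ
  bl zero    = 0 , 0
  bl (suc i) = if isLoose (bl i) then (proj₁ (bl i) , suc (proj₂ (bl i))) else (suc (proj₁ (bl i)) , proj₂ (bl i))

  za ob : ℕ → ℕ
  za i = proj₁ (bl i)
  ob i = proj₂ (bl i)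

  -- `bl` adds a one exactly after a loose block. Removing that one leaves an admissible block
  -- precisely when c p ≤ d b, so the condition on followers of loose blocks is `loose` shifted by
  -- one; its series is therefore x times that of `loose`.
  loose tightStart hasOne : ℕ → Bool
  loose i = isLoose (bl i)
  tightStart zero    = false
  tightStart (suc i) = loose i
  hasOne i = 0 <ᵇ ob i

  isLoose-true : ∀ x → isLoose x ≡ true → d * suc (proj₂ x) < c * suc (proj₁ x)
  isLoose-true x eq = ℕP.<ᵇ⇒< _ _ (subst T (sym eq) _)

  isLoose-false : ∀ x → isLoose x ≡ false → c * suc (proj₁ x) ≤ d * suc (proj₂ x)
  isLoose-false x eq = ℕP.≮⇒≥ λ lt → subst T eq (ℕP.<⇒<ᵇ lt)

  isLoose-intro : ∀ x → d * suc (proj₂ x) < c * suc (proj₁ x) → isLoose x ≡ true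
  isLoose-intro x lt with isLoose x in eq
  ... | true  = refl
  ... | false = contradiction lt (ℕP.≤⇒≯ (isLoose-false x eq))

  isLoose-elim : ∀ x → c * suc (proj₁ x) ≤ d * suc (proj₂ x) → isLoose x ≡ false
  isLoose-elim x le with isLoose x in eq
  ... | false = refl
  ... | true  = contradiction (isLoose-true x eq) (ℕP.≤⇒≯ le)

  size : ∀ i → za i + ob i ≡ i
  size zero    = refl
  size (suc i) with isLoose (bl i)
  ... | true  = trans (ℕP.+-suc (za i) (ob i)) (cong suc (size i))
  ... | false = cong suc (size i)

  admissible : ∀ i → Admissible (bl i)
  admissible zero = subst₂ _<_ (sym (ℕP.*-zeroʳ d)) (sym (ℕP.*-identityʳ c)) 1≤c
                  , subst (_≤ d * 1) (sym (ℕP.*-zeroʳ c)) z≤n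
  admissible (suc i) with isLoose (bl i) in eq
  ... | true  = isLoose-true (bl i) eq
              , ℕP.≤-trans (proj₂ (admissible i)) (ℕP.*-monoʳ-≤ d (ℕP.n≤1+n _))
  ... | false = ℕP.<-≤-trans (proj₁ (admissible i)) (ℕP.*-monoʳ-≤ c (ℕP.n≤1+n _))
              , isLoose-false (bl i) eq

  -- More ones at equal length mean fewer zeros, and then c(p′+1) ≤ c p ≤ d(b+1) ≤ d b′ < c(p′+1).
  ones-determined : ∀ {p b p′ b′} → Admissible (p , b) → Admissible (p′ , b′) → p + b ≡ p′ + b′ → ¬ b < b′
  ones-determined {p} {b} {p′} {b′} (_ , up) (lo , _) eq b<b′ =
    ℕP.<-irrefl refl (ℕP.≤-<-trans (ℕP.≤-trans (ℕP.*-monoʳ-≤ c p′<p) (ℕP.≤-trans up (ℕP.*-monoʳ-≤ d b<b′))) lo)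
    where
    p′<p : p′ < p
    p′<p = ℕP.+-cancelʳ-< b′ p′ p (subst (_< p + b′) eq (ℕP.+-monoʳ-< p b<b′))

  admissible-unique : ∀ p b → Admissible (p , b) → bl (p + b) ≡ (p , b)
  admissible-unique p b adm with ℕP.<-cmp (ob (p + b)) b
  ... | tri< lt _ _ = contradiction lt (ones-determined (admissible (p + b)) adm (size (p + b)))
  ... | tri> _ _ gt = contradiction gt (ones-determined adm (admissible (p + b)) (sym (size (p + b))))
  ... | tri≈ _ eq _ = cong₂ _,_ (ℕP.+-cancelʳ-≡ b _ p (trans (cong (λ k → za (p + b) + k) (sym eq)) (size (p + b)))) eq

  hasOne-intro : ∀ i → 1 ≤ ob i → hasOne i ≡ true
  hasOne-intro i le with ob i
  ... | suc _ = refl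

  hasOne-elim : ∀ i → hasOne i ≡ true → 1 ≤ ob i
  hasOne-elim i eq with ob i
  ... | suc _ = s≤s z≤n

  tightStart-elim : ∀ i → tightStart i ≡ true → c * za i ≤ d * ob i × 1 ≤ ob i
  tightStart-elim (suc i) eq with isLoose (bl i)
  ... | true = proj₂ (admissible i) , s≤s z≤n

  tightStart-intro : ∀ i → c * za i ≤ d * ob i → 1 ≤ ob i → tightStart i ≡ true
  tightStart-intro (suc i) le 1≤b with isLoose (bl i)
  ... | true  = refl
  ... | false = contradiction (proj₁ (admissible i)) (ℕP.≤⇒≯ le)

  -- Here q ≤ 1 enters: passing from c p ≤ d b to the successors adds c on the left and d ≥ c on the
  -- right. Hence a loose block is never followed by another loose one.
  tightStart⇒¬loose : ∀ i → tightStart i ≡ true → loose i ≡ false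
  tightStart⇒¬loose i st = isLoose-elim (bl i) (begin
    c * suc (za i)   ≡⟨ ℕP.*-suc c (za i) ⟩
    c + c * za i     ≤⟨ ℕP.+-mono-≤ c≤d (proj₁ (tightStart-elim i st)) ⟩
    d + d * ob i     ≡⟨ ℕP.*-suc d (ob i) ⟨
    d * suc (ob i)   ∎)
    where open ℕP.≤-Reasoning

  tightStart⇒hasOne : ∀ i → tightStart i ≡ true → hasOne i ≡ true
  tightStart⇒hasOne i st = hasOne-intro i (proj₂ (tightStart-elim i st))

  ob-mono : ∀ i → ob i ≤ ob (suc i)
  ob-mono i with isLoose (bl i)
  ... | true  = ℕP.n≤1+n _
  ... | false = ℕP.≤-refl

  hasOne-suc : ∀ i → hasOne i ≡ true → hasOne (suc i) ≡ true
  hasOne-suc i h = hasOne-intro (suc i) (ℕP.≤-trans (hasOne-elim i h) (ob-mono i))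

  -- Meet-irreducible words

  -- A structural form of `QDecList`: zero runs are tested at the start and after each one. The ones
  -- need not be maximal here, since taking fewer of them only weakens the bound.
  Run : List Bool → Set
  Run w = ∀ a b v → w ≡ 0^ (suc a) ++ 1^ b ++ v → d * b < c * suc a

  AfterOne : List Bool → Set
  AfterOne []          = ⊤
  AfterOne (true ∷ w)  = Run w × AfterOne w
  AfterOne (false ∷ w) = AfterOne w

  Valid : List Bool → Set
  Valid w = Run w × AfterOne w

  d*0<c*suc : ∀ a → d * 0 < c * suc a
  d*0<c*suc a = subst (_< c * suc a) (sym (ℕP.*-zeroʳ d)) (ℕP.*-mono-≤ 1≤c (s≤s (z≤n {a})))

  QDec⇒Valid : ∀ {w} → QDecList c d w → Valid w
  QDec⇒Valid {w} q = (λ a b v eq → factor [] a b v eq (inj₁ refl)) , afterOne [] w refl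
    where
    factor : ∀ u a b v → w ≡ u ++ 0^ (suc a) ++ 1^ b ++ v → LeftMax (suc a) u → d * b < c * suc a
    factor u a zero    v eq lm = d*0<c*suc a
    factor u a (suc b) v eq lm with leadingOnes v
    ... | k , v′ , refl , st with q u (suc a) (suc (b + k)) v′
            (trans eq (cong (λ x → u ++ 0^ (suc a) ++ true ∷ x) (sym (replicate-+ b k true v′)))) lm (Stop⇒RightMax (b + k) st)
    ... | inj₂ lt = ℕP.≤-<-trans (ℕP.*-monoʳ-≤ d (s≤s (ℕP.m≤m+n b k))) lt
    afterOne : ∀ u x → w ≡ u ++ x → AfterOne x
    afterOne u []          eq = tt
    afterOne u (false ∷ x) eq = afterOne (u ++ [ false ]) x (trans eq (sym (ListP.++-assoc u [ false ] x)))
    afterOne u (true ∷ x)  eq = (λ a b v eq″ → factor (u ++ [ true ]) a b v (trans eq′ (cong ((u ++ [ true ]) ++_) eq″)) (inj₂ (s≤s z≤n , u , refl)))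
                              , afterOne (u ++ [ true ]) x eq′
      where
      eq′ : w ≡ (u ++ [ true ]) ++ x
      eq′ = trans eq (sym (ListP.++-assoc u [ true ] x))

  AfterOne-Valid : ∀ u {w} → AfterOne (u ++ true ∷ w) → Valid w
  AfterOne-Valid []          ao = ao
  AfterOne-Valid (true ∷ u)  ao = AfterOne-Valid u (proj₂ ao)
  AfterOne-Valid (false ∷ u) ao = AfterOne-Valid u ao

  Valid-factor : ∀ {w} → Valid w → ∀ u a b v → w ≡ u ++ 0^ (suc a) ++ 1^ b ++ v → LeftMax (suc a) u → d * b < c * suc a
  Valid-factor (r , _)  .[] a b v eq (inj₁ refl) = r a b v eq
  Valid-factor (_ , ao) ._  a b v refl (inj₂ (_ , u , refl)) =
    proj₁ (AfterOne-Valid u (subst AfterOne (ListP.++-assoc u [ true ] _) ao)) a b v refl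

  Valid⇒QDec : ∀ {w} → Valid w → QDecList c d w
  Valid⇒QDec vw u zero    b v eq lm rm = inj₁ refl
  Valid⇒QDec vw u (suc a) b v eq lm rm = inj₂ (Valid-factor vw u a b v eq lm)

  Valid-[] : Valid []
  Valid-[] = (λ _ _ _ ()) , tt

  Valid-1^ : ∀ e {w} → Valid w → Valid (1^ e ++ w)
  Valid-1^ zero    vw = vw
  Valid-1^ (suc e) vw = (λ _ _ _ ()) , Valid-1^ e vw

  AfterOne-0^ : ∀ p {w} → AfterOne w → AfterOne (0^ p ++ w)
  AfterOne-0^ zero    ao = ao
  AfterOne-0^ (suc p) ao = AfterOne-0^ p ao

  AfterOne-0^⁻ : ∀ p {w} → AfterOne (0^ p ++ w) → AfterOne w
  AfterOne-0^⁻ zero    ao = ao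
  AfterOne-0^⁻ (suc p) ao = AfterOne-0^⁻ p ao

  Valid-block : ∀ p b {w} → RightMax b w → Valid w → d * b < c * suc p → Valid (block p b ++ w)
  Valid-block p b {w} rm vw lt = subst Valid (sym (block-++ p b w)) (isRun , AfterOne-0^ (suc p) (after b))
    where
    after : ∀ b → AfterOne (1^ b ++ w)
    after zero    = proj₂ vw
    after (suc b) = Valid-1^ b vw
    isRun : Run (0^ (suc p) ++ 1^ b ++ w)
    isRun a b′ v eq with parse-≤ (suc p) (suc a) b b′ rm eq
    ... | inj₁ (refl , le) = ℕP.≤-<-trans (ℕP.*-monoʳ-≤ d le) lt
    ... | inj₂ refl        = d*0<c*suc a

  Valid-block-< : ∀ p b {w} → Valid (block p b ++ w) → d * b < c * suc p
  Valid-block-< p b {w} (r , _) = r p b w (block-++ p b w)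

  Valid-block-tail : ∀ p b {w} → RightMax b w → Valid (block p b ++ w) → Valid w
  Valid-block-tail p b (inj₁ refl) _ = Valid-[]
  Valid-block-tail p (suc b) {w} (inj₂ _) (_ , ao) =
    AfterOne-Valid (0^ (suc p) ++ 1^ b) (subst AfterOne (trans (block-++ p (suc b) w)
      (trans (cong (0^ (suc p) ++_) (sym (replicate-shift b true w))) (sym (ListP.++-assoc (0^ (suc p)) (1^ b) _)))) ao)

  -- If the first t letters of x are not all one, their last zero run has length at most t and is
  -- followed in x by at least b ones.
  above-block : ∀ t b {w x} → Valid x → 0^ t ++ 1^ b ++ w ⊑ x → (∃ λ x′ → x ≡ 1^ (t + b) ++ x′) ⊎ d * b < c * t
  above-block t b {w} vx le with ++-below (0^ t) le
  ... | x₁ , _ , refl , len , le₂ with ones-above b le₂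
  ... | x₃ , refl , _ with lastZero x₁
  ... | inj₁ eq = inj₁ (x₃ , trans (cong (_++ 1^ b ++ x₃) (trans eq (cong 1^ (trans len (ListP.length-replicate t)))))
                                   (sym (replicate-+ t b true x₃)))
  ... | inj₂ (u , z , o , refl , lm , z<len) = inj₂ (begin-strict
    d * b       ≤⟨ ℕP.*-monoʳ-≤ d (ℕP.m≤n+m b o) ⟩
    d * (o + b) <⟨ Valid-factor vx u z (o + b) x₃ shape lm ⟩
    c * suc z   ≤⟨ ℕP.*-monoʳ-≤ c (subst (suc z ≤_) (trans len (ListP.length-replicate t)) z<len) ⟩
    c * t       ∎)
    where
    open ℕP.≤-Reasoning
    shape : (u ++ 0^ (suc z) ++ 1^ o) ++ 1^ b ++ x₃ ≡ u ++ 0^ (suc z) ++ 1^ (o + b) ++ x₃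
    shape = trans (ListP.++-assoc u _ _) (cong (u ++_) (trans (ListP.++-assoc (0^ (suc z)) (1^ o) _)
      (cong (0^ (suc z) ++_) (sym (replicate-+ o b true x₃)))))

  -- Suppose a later zero is raised; the first such zero leaves s + 1 zeros before it and t letters
  -- of the run after it. If these t letters all become ones, the first run carries at least b + 1
  -- ones, too many for s + 1 ≤ p zeros. Otherwise d < c(s+1) and d b < c t, and the sum contradicts
  -- c p ≤ d(b+1).
  block-rigid : ∀ p b {w r} → Admissible (p , b) → Valid (false ∷ r) → block p b ++ w ⊑ false ∷ r →
    ∃ λ r′ → false ∷ r ≡ block p b ++ r′ × w ⊑ r′
  block-rigid p b {w} {r} (_ , up) vr (_ ∷ le) with firstOne p (subst (_⊑ r) (ListP.++-assoc (0^ p) (1^ b) w) le)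
  block-rigid p b {w} (_ , up) vr (_ ∷ le) | inj₁ (_ , refl , le₂) with ones-above b le₂
  ... | r′ , refl , le₃ = r′ , sym (block-++ p b r′) , le₃
  block-rigid p b {w} (_ , up) vr (_ ∷ le) | inj₂ (s , t , x , refl , refl , le₂)
    with above-block t b (AfterOne-Valid (0^ s) (proj₂ vr)) le₂
  ... | inj₁ (x′ , refl) = contradiction (proj₁ vr s (suc (t + b)) x′ refl) (ℕP.≤⇒≯ (begin
    c * suc s       ≤⟨ ℕP.*-monoʳ-≤ c (s≤s (ℕP.m≤m+n s t)) ⟩
    c * (suc s + t) ≤⟨ up ⟩
    d * suc b       ≤⟨ ℕP.*-monoʳ-≤ d (s≤s (ℕP.m≤n+m b t)) ⟩
    d * suc (t + b) ∎))
    where open ℕP.≤-Reasoning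
  ... | inj₂ lt = contradiction (begin-strict
    d * suc b         ≡⟨ trans (ℕP.*-suc d b) (cong (_+ d * b) (sym (ℕP.*-identityʳ d))) ⟩
    d * 1 + d * b     <⟨ ℕP.+-mono-< (proj₁ vr s 1 x refl) lt ⟩
    c * suc s + c * t ≡⟨ ℕP.*-distribˡ-+ c (suc s) t ⟨
    c * (suc s + t)   ∎) (ℕP.≤⇒≯ up)
    where open ℕP.≤-Reasoning

  -- Chains of admissible blocks and their rigidity

  blk : ℕ → List Bool
  blk i = block (za i) (ob i)

  data Chain : ℕ → List Bool → Set where
    last : ∀ i → Chain i (blk i ++ [])
    cons : ∀ i {j w} → hasOne i ≡ true → (loose i ≡ true → tightStart j ≡ true) → Chain j w → Chain i (blk i ++ w)

  Chain-view : ∀ {i w} → Chain i w → ∃ λ v → w ≡ blk i ++ v × RightMax (ob i) v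
  Chain-view (last i) = [] , refl , inj₁ refl
  Chain-view (cons i {w = w} h _ ch) with Chain-view ch
  ... | _ , refl , _ = w , refl , inj₂ (hasOne-elim i h , _ , refl)

  Chain-valid : ∀ {i w} → Chain i w → Valid w
  Chain-valid (last i) = Valid-block (za i) (ob i) (inj₁ refl) Valid-[] (proj₁ (admissible i))
  Chain-valid {w = w} ch@(cons i h _ ch′) with Chain-view ch′
  ... | _ , refl , _ = Valid-block (za i) (ob i) (inj₂ (hasOne-elim i h , _ , refl)) (Chain-valid ch′) (proj₁ (admissible i))

  -- A further one fits after block i only if that block is loose, so block j satisfies c p ≤ d b
  -- and b ≥ 1. By the first inequality no zero can survive in block j. All its letters then join
  -- the ones of block i, giving at least `ob i` + 2 of them, while c ≤ d and admissibility of block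
  -- i yield c(`za i` + 1) ≤ d(`ob i` + 2).
  no-early-one : ∀ i j {v x} → (loose i ≡ true → tightStart j ≡ true) → Valid (blk i ++ true ∷ x) → ¬ blk j ++ v ⊑ true ∷ x
  no-early-one i j {v} {x} link vr (_ ∷ le) =
    impossible (above-block (za j) (ob j) (AfterOne-Valid (blk i) (proj₂ vr))
      (subst (_⊑ x) (ListP.++-assoc (0^ (za j)) (1^ (ob j)) v) le))
    where
    open ℕP.≤-Reasoning
    st : c * za j ≤ d * ob j × 1 ≤ ob j
    st = tightStart-elim j (link (isLoose-intro (bl i) (Valid-block-< (za i) (suc (ob i)) (subst Valid (block-true (za i) (ob i) x) vr))))
    bound : c * suc (za i) ≤ d * (suc (ob i) + (za j + ob j))
    bound = begin
      c * suc (za i)                   ≡⟨ ℕP.*-suc c (za i) ⟩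
      c + c * za i                     ≤⟨ ℕP.+-mono-≤ c≤d (proj₂ (admissible i)) ⟩
      d + d * suc (ob i)               ≡⟨ ℕP.*-suc d (suc (ob i)) ⟨
      d * suc (suc (ob i))             ≡⟨ cong (d *_) (ℕP.+-comm 1 (suc (ob i))) ⟩
      d * (suc (ob i) + 1)             ≤⟨ ℕP.*-monoʳ-≤ d (ℕP.+-monoʳ-≤ (suc (ob i)) (ℕP.≤-trans (proj₂ st) (ℕP.m≤n+m (ob j) (za j)))) ⟩
      d * (suc (ob i) + (za j + ob j)) ∎
    shape : ∀ x′ → blk i ++ true ∷ 1^ (za j + ob j) ++ x′ ≡ block (za i) (suc (ob i) + (za j + ob j)) ++ x′
    shape x′ = trans (block-true (za i) (ob i) _) (trans (block-++ (za i) (suc (ob i)) _)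
      (trans (cong (0^ (suc (za i)) ++_) (sym (replicate-+ (suc (ob i)) (za j + ob j) true x′))) (sym (block-++ (za i) _ x′))))
    impossible : ¬ ((∃ λ x′ → x ≡ 1^ (za j + ob j) ++ x′) ⊎ d * ob j < c * za j)
    impossible (inj₂ lt) = ℕP.<⇒≱ lt (proj₁ st)
    impossible (inj₁ (x′ , refl)) = ℕP.<⇒≱ (Valid-block-< (za i) (suc (ob i) + (za j + ob j)) {x′} (subst Valid (shape x′) vr)) bound

  -- Rigidity travels from left to right: `block-rigid` fixes the current block, and `no-early-one`
  -- preserves the first zero of the next, which is what `block-rigid` needs there.
  Chain-rigid : ∀ {i w r} → Chain i w → Valid (false ∷ r) → w ⊑ false ∷ r → false ∷ r ≡ w
  Chain-rigid (last i) vr le with block-rigid (za i) (ob i) (admissible i) vr le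
  ... | _ , eq , [] = eq
  Chain-rigid (cons i {j} h link ch) vr le with block-rigid (za i) (ob i) (admissible i) vr le | Chain-view ch
  ... | false ∷ r′ , eq , le′ | _ = trans eq (cong (blk i ++_) (Chain-rigid ch
          (Valid-block-tail (za i) (ob i) (inj₂ (hasOne-elim i h , _ , refl)) (subst Valid eq vr)) le′))
  ... | true ∷ _ , eq , le′ | _ , refl , _ = contradiction le′ (no-early-one i j link (subst Valid eq vr))
  ... | [] , eq , () | _ , refl , _

  -- Such a word is the meet of 1⋯1 suf and 0 pre suf′.
  Reducible : List Bool → Set
  Reducible w = ∃ λ pre → ∃₂ λ suf suf′ → w ≡ false ∷ pre ++ suf × Valid suf × Valid (false ∷ pre ++ suf′)
    × suf ⊑ suf′ × suf ≢ suf′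

  switch-⊑ : ∀ p w → 0^ (suc p) ++ w ⊑ 0^ p ++ true ∷ w
  switch-⊑ zero    w = f≤t ∷ ⊑-refl
  switch-⊑ (suc p) w = b≤b ∷ switch-⊑ p w

  switch-≢ : ∀ p w → 0^ (suc p) ++ w ≢ 0^ p ++ true ∷ w
  switch-≢ zero    w ()
  switch-≢ (suc p) w eq = switch-≢ p w (ListP.∷-injectiveʳ eq)

  -- The inequality forces p ≥ 1 and makes 0^p 1^(b+1) valid, so the last zero of the block can be
  -- raised while the first one stays.
  widen : ∀ p b {v} → Valid (block p b ++ v) → d * suc b < c * p → RightMax b v → Valid v → Reducible (block p b ++ v)
  widen zero    b vw lt rm vv = contradiction (subst (d * suc b <_) (ℕP.*-zeroʳ c) lt) λ ()
  widen (suc p) b {v} vw lt rm vv =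
    [] , block p b ++ v , 0^ p ++ true ∷ 1^ b ++ v , refl ,
    Valid-block p b rm vv (ℕP.≤-<-trans (ℕP.*-monoʳ-≤ d (ℕP.n≤1+n b)) lt) ,
    subst Valid (block-++ p (suc b) v) (Valid-block p (suc b) (Stop⇒RightMax b (RightMax⇒Stop b rm)) vv lt) ,
    subst (_⊑ (0^ p ++ true ∷ 1^ b ++ v)) (sym (block-++ p b v)) (switch-⊑ p (1^ b ++ v)) ,
    λ eq → switch-≢ p (1^ b ++ v) (trans (sym (block-++ p b v)) eq)

  -- The enlarged tail still begins with a zero, so the ones of the new block do not grow and its
  -- bound is unaffected.
  prepend : ∀ p b {v} → RightMax b v → d * b < c * suc p → Reducible v → Reducible (block p b ++ v)
  prepend p b (inj₁ refl) lt (_ , _ , _ , () , _)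
  prepend p b (inj₂ (1≤b , _)) lt (pre , suf , suf′ , refl , vs , vw′ , le , ne) =
    (0^ p ++ 1^ b) ++ false ∷ pre , suf , suf′ , assoc suf , vs ,
    subst Valid (assoc suf′) (Valid-block p b (inj₂ (1≤b , _ , refl)) vw′ lt) , le , ne
    where
    assoc : ∀ x → block p b ++ false ∷ pre ++ x ≡ false ∷ ((0^ p ++ 1^ b) ++ false ∷ pre) ++ x
    assoc x = cong (false ∷_) (sym (ListP.++-assoc (0^ p ++ 1^ b) (false ∷ pre) x))

  -- The loose block can absorb the first zero of its follower once this zero is raised. What
  -- remains of the follower is valid if c p > d b; otherwise it has no one, hence p = 0, and it is
  -- a single final zero that leaves nothing behind.
  unlinked : ∀ p b j {v} → d * suc b < c * suc p → tightStart j ≡ false → Valid (blk j ++ v) → RightMax (ob j) v →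
    Reducible (block p b ++ blk j ++ v)
  unlinked p b j {v} lt nst vv rm with c * za j ℕP.≤? d * ob j
  ... | no ≰ = fill (za j) (ob j) (ℕP.≰⇒> ≰) rm vv
    where
    fill : ∀ p₂ b₂ → d * b₂ < c * p₂ → RightMax b₂ v → Valid (block p₂ b₂ ++ v) → Reducible (block p b ++ block p₂ b₂ ++ v)
    fill zero b₂ lt₂ _ _ = contradiction (subst (d * b₂ <_) (ℕP.*-zeroʳ c) lt₂) λ ()
    fill (suc p₂) b₂ lt₂ rm vv = 0^ p ++ 1^ b , block (suc p₂) b₂ ++ v , true ∷ block p₂ b₂ ++ v , refl , vv ,
      subst Valid (sym (block-true p b _)) (Valid-block p (suc b) (inj₂ (s≤s z≤n , _ , refl))
        (Valid-block p₂ b₂ rm (Valid-block-tail (suc p₂) b₂ rm vv) lt₂) lt) ,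
      f≤t ∷ ⊑-refl , λ ()
  ... | yes le = single (za j) (ob j) le b₂≡0 rm vv
    where
    b₂≡0 : ob j ≡ 0
    b₂≡0 = ℕP.n<1⇒n≡0 (ℕP.≰⇒> λ 1≤b → contradiction (trans (sym nst) (tightStart-intro j le 1≤b)) λ ())
    single : ∀ p₂ b₂ → c * p₂ ≤ d * b₂ → b₂ ≡ 0 → RightMax b₂ v → Valid (block p₂ b₂ ++ v) → Reducible (block p b ++ block p₂ b₂ ++ v)
    single zero .0 _ refl (inj₁ refl) vv = 0^ p ++ 1^ b , [ false ] , [ true ] , refl , vv ,
      subst Valid (sym (block-true p b [])) (Valid-block p (suc b) (inj₁ refl) Valid-[] lt) , f≤t ∷ [] , λ ()
    single zero .0 _ refl (inj₂ (() , _)) vv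
    single (suc p₂) .0 le refl _ _ = contradiction (ℕP.≤-trans (ℕP.*-mono-≤ 1≤c (s≤s (z≤n {p₂}))) (subst (c * suc p₂ ≤_) (ℕP.*-zeroʳ d) le)) λ ()

  -- Three things can prevent a chain: the upper bound on the first block, the tail, or the link
  -- between them. They are answered by `widen`, `prepend` and `unlinked`; maximality of the runs
  -- supplies `hasOne`.
  classify : ∀ {w} → Runs w → Valid w → w ≡ [] ⊎ (∃ λ i → Chain i w) ⊎ Reducible w
  classify nil vw = inj₁ refl
  classify (run p b {v} rm rs) vw with c * p ℕP.≤? d * suc b
  ... | no ≰ = inj₂ (inj₂ (widen p b vw (ℕP.≰⇒> ≰) rm (Valid-block-tail p b rm vw)))
  ... | yes le = inj₂ (extend rm (classify rs (Valid-block-tail p b rm vw)))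
    where
    lt : d * b < c * suc p
    lt = Valid-block-< p b vw
    bl≡ : bl (p + b) ≡ (p , b)
    bl≡ = admissible-unique p b (lt , le)
    extend : RightMax b v → v ≡ [] ⊎ (∃ λ j → Chain j v) ⊎ Reducible v → (∃ λ i → Chain i (block p b ++ v)) ⊎ Reducible (block p b ++ v)
    extend rm (inj₁ refl) = inj₁ (p + b , subst (λ x → Chain (p + b) (block (proj₁ x) (proj₂ x) ++ [])) bl≡ (last (p + b)))
    extend rm (inj₂ (inj₂ red)) = inj₂ (prepend p b rm lt red)
    extend rm (inj₂ (inj₁ (j , ch))) with Chain-view ch
    extend (inj₂ (1≤b , _)) (inj₂ (inj₁ (j , ch))) | v′ , refl , rm′
      with isLoose (p , b) in eqL | tightStart j in eqS
    ... | true | false = inj₂ (unlinked p b j (isLoose-true (p , b) eqL) eqS (Chain-valid ch) rm′)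
    ... | false | _ = inj₁ (p + b , subst (λ x → Chain (p + b) (block (proj₁ x) (proj₂ x) ++ blk j ++ v′)) bl≡
         (cons (p + b) (hasOne-intro (p + b) (subst (λ x → 1 ≤ proj₂ x) (sym bl≡) 1≤b))
           (λ l → contradiction (trans (sym l) (trans (cong isLoose bl≡) eqL)) λ ()) ch))
    ... | true | true = inj₁ (p + b , subst (λ x → Chain (p + b) (block (proj₁ x) (proj₂ x) ++ blk j ++ v′)) bl≡
         (cons (p + b) (hasOne-intro (p + b) (subst (λ x → 1 ≤ proj₂ x) (sym bl≡) 1≤b)) (λ _ → eqS) ch))

  -- Chain words are exactly the meet-irreducible elements

  ChainWord : List Bool → Set
  ChainWord l = ∃₂ λ e v → ∃ λ i → l ≡ 1^ e ++ v × Chain i v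

  Valid-1^⁻ : ∀ e {w} → Valid (1^ e ++ w) → Valid w
  Valid-1^⁻ zero    vw = vw
  Valid-1^⁻ (suc e) vw = Valid-1^⁻ e (proj₂ vw)

  Valid-0^ : ∀ k → Valid (0^ k)
  Valid-0^ zero    = Valid-[]
  Valid-0^ (suc k) = subst Valid (trans (ListP.++-identityʳ (block k 0)) (ListP.++-identityʳ (0^ (suc k))))
    (Valid-block k 0 (inj₁ refl) Valid-[] (d*0<c*suc k))

  toList-QDec : ∀ {n} (v : Word n) {l} → toList v ≡ l → Valid l → QDec c d v
  toList-QDec v eq vl = Valid⇒QDec (subst Valid (sym eq) vl)

  module _ {n : ℕ} (P : Word n) where

    above-chain : ∀ {e w i} → toList P ≡ 1^ e ++ w → Chain i w → ∀ R → QDec c d R → P ≤ʷ R →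
      P ≡ R ⊎ ∃ λ r → toList R ≡ 1^ e ++ true ∷ r
    above-chain {e} eqP ch R qR P≤R with ones-above e (subst (_⊑ toList R) eqP (≤ʷ⇒⊑ P R P≤R))
    ... | true ∷ r , eqR , _ = inj₂ (r , eqR)
    ... | false ∷ r , eqR , le = inj₁ (toList-inj (trans eqP (trans (cong (1^ e ++_)
            (sym (Chain-rigid ch (Valid-1^⁻ e (subst Valid eqR (QDec⇒Valid qR))) le))) (sym eqR))))
    ... | [] , _ , le with Chain-view ch
    above-chain eqP ch R qR P≤R | [] , _ , () | _ , refl , _

    chain⇒meetIrr : ChainWord (toList P) → MeetIrr c d n P
    chain⇒meetIrr (e , _ , i , eqP , ch) with Chain-view ch
    ... | v , refl , _ = toList-QDec P eqP (Valid-1^ e (Chain-valid ch)) , notTop , irr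
      where
      notTop : ¬ IsTop c d P
      notTop top with word {n} (1^ n) (ListP.length-replicate n)
      ... | T , eqT = 1^-⋢ n e (subst₂ _⊑_ eqT eqP (≤ʷ⇒⊑ T P (top T (toList-QDec T eqT
              (subst Valid (ListP.++-identityʳ (1^ n)) (Valid-1^ n Valid-[]))))))
      length-≡ : ∀ x y → length (1^ e ++ true ∷ x) ≡ length (1^ e ++ false ∷ y) → length x ≡ length y
      length-≡ x y eq = ℕP.suc-injective (ℕP.+-cancelˡ-≡ (length (1^ e)) _ _
        (trans (sym (ListP.length-++ (1^ e))) (trans eq (ListP.length-++ (1^ e)))))
      tail : List Bool
      tail = (0^ (za i) ++ 1^ (ob i)) ++ v
      irr : ∀ R S → QDec c d R → QDec c d S → IsMeet c d P R S → P ≡ R ⊎ P ≡ S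
      irr R S qR qS (P≤R , P≤S , glb) with above-chain {e} eqP ch R qR P≤R | above-chain {e} eqP ch S qS P≤S
      ... | inj₁ eq | _       = inj₁ eq
      ... | inj₂ _  | inj₁ eq = inj₂ eq
      -- The word 1^(e+1) 0⋯0 is the least one with this prefix, so it lies below both `R` and `S`
      -- but not below `P`.
      ... | inj₂ (r , eqR) | inj₂ (s , eqS) with word {n} (1^ e ++ true ∷ 0^ (length tail))
              (trans (ListP.length-++ (1^ e)) (trans (cong (λ k → length (1^ e) + suc k) (ListP.length-replicate (length tail)))
                (trans (sym (ListP.length-++ (1^ e))) (trans (cong length (sym eqP)) (VecP.length-toList P)))))
      ... | T , eqT = contradiction (subst₂ _⊑_ eqT eqP (≤ʷ⇒⊑ T P
              (glb T (toList-QDec T eqT (Valid-1^ e (Valid-1^ 1 (Valid-0^ (length tail))))) (T≤ R eqR) (T≤ S eqS)))) (true-⋢ e)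
        where
        T≤ : ∀ Q {q} → toList Q ≡ 1^ e ++ true ∷ q → T ≤ʷ Q
        T≤ Q {q} eqQ = ⊑⇒≤ʷ T Q (subst₂ _⊑_
          (trans (cong (λ k → 1^ e ++ true ∷ 0^ k) (length-≡ q tail
            (trans (cong length (sym eqQ)) (trans (VecP.length-toList Q) (trans (sym (VecP.length-toList P)) (cong length eqP))))))
            (sym eqT)) (sym eqQ)
          (Pw.++⁺ (⊑-refl {1^ e}) (b≤b ∷ 0^-⊑ q)))

    reducible⇒¬meetIrr : ∀ e {w} → toList P ≡ 1^ e ++ w → Reducible w → ¬ MeetIrr c d n P
    reducible⇒¬meetIrr e eqP (pre′ , suf , suf′ , refl , vs , vw′ , le , ne) (_ , _ , irr) = go (irr R S qR qS meet)
      where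
      pre : List Bool
      pre = 1^ e ++ false ∷ pre′
      eqP′ : toList P ≡ pre ++ suf
      eqP′ = trans eqP (sym (ListP.++-assoc (1^ e) (false ∷ pre′) suf))
      length-pre : length pre + length suf ≡ n
      length-pre = trans (sym (ListP.length-++ pre)) (trans (cong length (sym eqP′)) (VecP.length-toList P))
      R∃ : ∃ λ (R : Word n) → toList R ≡ 1^ (length pre) ++ suf
      R∃ = word _ (trans (ListP.length-++ (1^ (length pre))) (trans (cong (_+ length suf) (ListP.length-replicate (length pre))) length-pre))
      S∃ : ∃ λ (S : Word n) → toList S ≡ pre ++ suf′
      S∃ = word _ (trans (ListP.length-++ pre) (trans (cong (λ k → length pre + k) (sym (Pw.Pointwise-length le))) length-pre))
      R S : Word n
      R = proj₁ R∃
      S = proj₁ S∃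
      qR : QDec c d R
      qR = toList-QDec R (proj₂ R∃) (Valid-1^ (length pre) vs)
      qS : QDec c d S
      qS = toList-QDec S (trans (proj₂ S∃) (ListP.++-assoc (1^ e) (false ∷ pre′) suf′)) (Valid-1^ e vw′)
      meet : IsMeet c d P R S
      meet = ⊑⇒≤ʷ P R (subst₂ _⊑_ (sym eqP′) (sym (proj₂ R∃)) (Pw.++⁺ (⊑-1^ pre) ⊑-refl))
           , ⊑⇒≤ʷ P S (subst₂ _⊑_ (sym eqP′) (sym (proj₂ S∃)) (Pw.++⁺ (⊑-refl {pre}) le))
           , λ T _ T≤R T≤S → ⊑⇒≤ʷ T P (subst (toList T ⊑_) (sym eqP′)
               (glue-⊑ pre (subst (toList T ⊑_) (proj₂ R∃) (≤ʷ⇒⊑ T R T≤R)) (subst (toList T ⊑_) (proj₂ S∃) (≤ʷ⇒⊑ T S T≤S))))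
      go : ¬ (P ≡ R ⊎ P ≡ S)
      go (inj₁ eq) = 1^-⋢ (length pre) e (subst (1^ (length pre) ⊑_)
        (sym (ListP.++-cancelʳ suf pre (1^ (length pre)) (trans (sym eqP′) (trans (cong toList eq) (proj₂ R∃))))) ⊑-refl)
      go (inj₂ eq) = ne (ListP.++-cancelˡ pre suf suf′ (trans (sym eqP′) (trans (cong toList eq) (proj₂ S∃))))

    meetIrr⇒chain : MeetIrr c d n P → ChainWord (toList P)
    meetIrr⇒chain irr@(q , notTop , _) with runs (toList P)
    ... | e , v , eqP , rs , _ with classify rs (Valid-1^⁻ e (subst Valid eqP (QDec⇒Valid q)))
    ... | inj₂ (inj₁ (i , ch)) = e , v , i , eqP , ch
    ... | inj₂ (inj₂ red) = contradiction irr (reducible⇒¬meetIrr e eqP red)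
    -- Without a zero, `P` is 1^n, the top element excluded by `MeetIrr`.
    ... | inj₁ refl = contradiction isTop notTop
      where
      eq1 : toList P ≡ 1^ n
      eq1 = trans eqP (trans (ListP.++-identityʳ (1^ e)) (cong 1^ (trans (sym (ListP.length-replicate e))
        (trans (cong length (sym (trans eqP (ListP.++-identityʳ (1^ e))))) (VecP.length-toList P)))))
      isTop : IsTop c d P
      isTop T _ = ⊑⇒≤ʷ T P (subst (toList T ⊑_) (trans (cong 1^ (VecP.length-toList T)) (sym eq1)) (⊑-1^ (toList T)))

  -- Enumeration

  canStart : Bool → ℕ → Bool
  canStart s i = if s then tightStart i else true

  -- The chains of length 1 + i + n whose first block has index at least i; if s holds, that block
  -- must be allowed to follow a loose one.
  chains : ℕ → Bool → ℕ → List (List Bool)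
  chains i s zero    = when (canStart s i) [ blk i ++ [] ]
  chains i s (suc n) = chains (suc i) s n ++ when (canStart s i ∧ hasOne i) (map (blk i ++_) (chains 0 (loose i) n))

  length-blk : ∀ i w → length (blk i ++ w) ≡ suc i + length w
  length-blk i w = trans (ListP.length-++ (blk i)) (cong (_+ length w)
    (trans (ListP.length-++ (0^ (suc (za i)))) (trans (cong₂ _+_ (ListP.length-replicate (suc (za i))) (ListP.length-replicate (ob i)))
      (cong suc (size i)))))

  Chain-nonempty : ∀ {i w} → Chain i w → 1 ≤ length w
  Chain-nonempty ch with Chain-view ch
  ... | _ , refl , _ = s≤s z≤n

  Chain-first : ∀ {i j w} → Chain i w → Chain j w → i ≡ j
  Chain-first {i} {j} ch ch′ with Chain-view ch | Chain-view ch′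
  ... | v , refl , rm | v′ , eq , rm′ with parse-unique (za i) (za j) (ob i) (ob j) rm rm′ eq
  ... | p≡ , b≡ = trans (sym (size i)) (trans (cong₂ _+_ p≡ b≡) (size j))

  canStart-elim : ∀ s i → canStart s i ≡ true → s ≡ true → tightStart i ≡ true
  canStart-elim true i eq refl = eq

  canStart-intro : ∀ s i → (s ≡ true → tightStart i ≡ true) → canStart s i ≡ true
  canStart-intro true  i f = f refl
  canStart-intro false i f = refl

  chains-sound : ∀ i s n {w} → w ∈ chains i s n →
    ∃ λ k → i ≤ k × Chain k w × (s ≡ true → tightStart k ≡ true) × length w ≡ suc (i + n)
  chains-sound i s zero w∈ with ∈-when (canStart s i) w∈
  ... | can , here refl = i , ℕP.≤-refl , last i , canStart-elim s i can , length-blk i []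
  chains-sound i s (suc n) w∈ with ∈-++⁻ (chains (suc i) s n) w∈
  ... | inj₁ w∈ˡ with chains-sound (suc i) s n w∈ˡ
  ... | k , i<k , ch , tight , len = k , ℕP.<⇒≤ i<k , ch , tight , trans len (cong suc (sym (ℕP.+-suc i n)))
  chains-sound i s (suc n) w∈ | inj₂ w∈ʳ with ∈-when (canStart s i ∧ hasOne i) w∈ʳ
  ... | cond , w∈m with ∈-map⁻ (blk i ++_) w∈m
  ... | v , v∈ , refl with chains-sound 0 (loose i) n v∈
  ... | k , _ , ch , link , len = i , ℕP.≤-refl , cons i (BoolP.∧-conicalʳ _ _ cond) link ch ,
    canStart-elim s i (BoolP.∧-conicalˡ _ _ cond) , trans (length-blk i v) (cong (λ l → suc i + l) len)

  chains-complete : ∀ i s n {k w} → i ≤ k → Chain k w → (s ≡ true → tightStart k ≡ true) → length w ≡ suc (i + n) →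
    w ∈ chains i s n
  chains-complete i s zero {k} {w} i≤k ch tight len = base ch k≡i len
    where
    k≡i : k ≡ i
    k≡i with Chain-view ch
    ... | v , refl , _ = ℕP.≤-antisym (ℕP.≤-trans (ℕP.m≤m+n k (length v))
      (ℕP.≤-reflexive (ℕP.suc-injective (trans (sym (length-blk k v)) (trans len (cong suc (ℕP.+-identityʳ i))))))) i≤k
    base : ∀ {w} → Chain k w → k ≡ i → length w ≡ suc (i + 0) → w ∈ chains i s 0
    base (last .k) refl _ rewrite canStart-intro s k tight = here refl
    base (cons .k {w = v} h link ch) refl len = contradiction (Chain-nonempty ch)
      (ℕP.<⇒≱ (s≤s (ℕP.≤-reflexive (ℕP.+-cancelˡ-≡ (suc k) _ _ (trans (sym (length-blk k v)) len)))))
  chains-complete i s (suc n) {k} i≤k ch tight len with ℕP.m≤n⇒m<n∨m≡n i≤k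
  ... | inj₁ i<k = ∈-++⁺ˡ (chains-complete (suc i) s n i<k ch tight (trans len (cong suc (ℕP.+-suc i n))))
  chains-complete i s (suc n) _ (last .i) tight len | inj₂ refl =
    contradiction (ℕP.+-cancelˡ-≡ (suc i) 0 (suc n) (trans (sym (length-blk i [])) len)) λ ()
  chains-complete i s (suc n) _ (cons .i {w = v} h link ch) tight len | inj₂ refl
    rewrite canStart-intro s i tight | h = ∈-++⁺ʳ (chains (suc i) s n) (∈-map⁺ (blk i ++_)
      (chains-complete 0 (loose i) n z≤n ch link (ℕP.+-cancelˡ-≡ (suc i) _ _ (trans (sym (length-blk i v)) len))))

  chains-unique : ∀ i s n → Unique (chains i s n)
  chains-unique i s zero    = Unique-when (canStart s i) ([] ∷ [])
  chains-unique i s (suc n) = UniqueP.++⁺ (chains-unique (suc i) s n)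
    (Unique-when (canStart s i ∧ hasOne i) (UniqueP.map⁺ (λ {x} {y} → ListP.++-cancelˡ (blk i) x y) (chains-unique 0 (loose i) n)))
    disjoint
    where
    disjoint : ∀ {w} → ¬ (w ∈ chains (suc i) s n × w ∈ when (canStart s i ∧ hasOne i) (map (blk i ++_) (chains 0 (loose i) n)))
    disjoint (w∈ˡ , w∈ʳ) with chains-sound (suc i) s n w∈ˡ | ∈-when (canStart s i ∧ hasOne i) w∈ʳ
    ... | k , i<k , chˡ , _ | cond , w∈m with ∈-map⁻ (blk i ++_) w∈m
    ... | v , v∈ , refl with chains-sound 0 (loose i) n v∈
    ... | _ , _ , ch , link , _ = ℕP.<⇒≢ i<k (Chain-first (cons i (BoolP.∧-conicalʳ _ _ cond) link ch) chˡ)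

  chainWords : ℕ → List (List Bool)
  chainWords zero    = []
  chainWords (suc n) = map (true ∷_) (chainWords n) ++ chains 0 false n

  chainWords-sound : ∀ n {w} → w ∈ chainWords n → length w ≡ n × ChainWord w
  chainWords-sound (suc n) w∈ with ∈-++⁻ (map (true ∷_) (chainWords n)) w∈
  ... | inj₂ w∈ʳ with chains-sound 0 false n w∈ʳ
  ... | k , _ , ch , _ , len = len , 0 , _ , k , refl , ch
  chainWords-sound (suc n) w∈ | inj₁ w∈ˡ with ∈-map⁻ (true ∷_) w∈ˡ
  ... | v , v∈ , refl with chainWords-sound n v∈
  ... | len , e , x , i , refl , ch = cong suc len , suc e , x , i , refl , ch

  chainWords-complete : ∀ n e {v i} → Chain i v → length (1^ e ++ v) ≡ n → 1^ e ++ v ∈ chainWords n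
  chainWords-complete zero e {v} ch len = contradiction (Chain-nonempty ch)
    (ℕP.<⇒≱ (s≤s (ℕP.≤-trans (ListP.length-++-≤ʳ v {1^ e}) (ℕP.≤-reflexive len))))
  chainWords-complete (suc n) zero    ch len = ∈-++⁺ʳ (map (true ∷_) (chainWords n)) (chains-complete 0 false n z≤n ch (λ ()) len)
  chainWords-complete (suc n) (suc e) ch len = ∈-++⁺ˡ (∈-map⁺ (true ∷_) (chainWords-complete n e ch (ℕP.suc-injective len)))

  chainWords-unique : ∀ n → Unique (chainWords n)
  chainWords-unique zero    = []
  chainWords-unique (suc n) = UniqueP.++⁺ (UniqueP.map⁺ ListP.∷-injectiveʳ (chainWords-unique n)) (chains-unique 0 false n) disjoint
    where
    disjoint : ∀ {w} → ¬ (w ∈ map (true ∷_) (chainWords n) × w ∈ chains 0 false n)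
    disjoint (w∈ˡ , w∈ʳ) with ∈-map⁻ (true ∷_) w∈ˡ | chains-sound 0 false n w∈ʳ
    ... | _ , _ , refl | _ , _ , ch , _ with Chain-view ch
    ... | _ , () , _

  count : ℕ → Bool → Series
  count i s n = + length (chains i s n)

  length-when : ∀ {A : Set} b (xs : List A) → + length (when b xs) ≡ bit b *ℤ + length xs
  length-when true  xs = sym (ℤP.*-identityˡ _)
  length-when false xs = refl

  -- Weights of a non-final first block, split by what may follow it: any chain, or only one with a
  -- tight start.
  tightW looseW : Bool → ℕ → ℤ
  tightW s i = bit ((canStart s i ∧ hasOne i) ∧ not (loose i))
  looseW s i = bit ((canStart s i ∧ hasOne i) ∧ loose i)

  -- The coefficients of G and G′ at n count chains of length n + 1.
  G G′ : Series
  G  = count 0 false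
  G′ = count 0 true

  count-suc : ∀ i s n → count i s (suc n) ≡ count (suc i) s n +ℤ (tightW s i *ℤ G n +ℤ looseW s i *ℤ G′ n)
  count-suc i s n = trans (cong +_ (ListP.length-++ (chains (suc i) s n))) (cong (count (suc i) s n +ℤ_)
    (trans (length-when (canStart s i ∧ hasOne i) _) (trans (cong (λ k → bit (canStart s i ∧ hasOne i) *ℤ + k) (ListP.length-map (blk i ++_) (chains 0 (loose i) n)))
      (choose (canStart s i ∧ hasOne i) (loose i)))))
    where
    choose : ∀ x y → bit x *ℤ + length (chains 0 y n) ≡ bit (x ∧ not y) *ℤ G n +ℤ bit (x ∧ y) *ℤ G′ n
    choose false y = refl
    choose true true  = sym (ℤP.+-identityˡ _)
    choose true false = sym (ℤP.+-identityʳ _)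

  dropS : ℕ → Series → Series
  dropS i f k = f (k + i)

  -- Iterating `count-suc` raises the least index until one block fills the whole length; that block
  -- gives the `bit` term, and each index passed gives one summand of the convolutions. The
  -- induction moves i, hence the shift `dropS`.
  count-unroll : ∀ n i s → count i s (suc n) ≡
    bit (canStart s (suc n + i)) +ℤ ((dropS i (tightW s) ⊛ G) n +ℤ (dropS i (looseW s) ⊛ G′) n)
  count-unroll zero i s = trans (count-suc i s 0) (cong (_+ℤ (tightW s i *ℤ G 0 +ℤ looseW s i *ℤ G′ 0))
    (trans (length-when (canStart s (suc i)) [ blk (suc i) ++ [] ]) (ℤP.*-identityʳ (bit (canStart s (suc i))))))
  count-unroll (suc n) i s = begin
    count i s (suc (suc n))
      ≡⟨ count-suc i s (suc n) ⟩
    count (suc i) s (suc n) +ℤ (tightW s i *ℤ G (suc n) +ℤ looseW s i *ℤ G′ (suc n))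
      ≡⟨ cong (_+ℤ (tightW s i *ℤ G (suc n) +ℤ looseW s i *ℤ G′ (suc n))) (count-unroll n (suc i) s) ⟩
    (bit (canStart s (suc n + suc i)) +ℤ ((dropS (suc i) (tightW s) ⊛ G) n +ℤ (dropS (suc i) (looseW s) ⊛ G′) n))
      +ℤ (tightW s i *ℤ G (suc n) +ℤ looseW s i *ℤ G′ (suc n))
      ≡⟨ regroup (bit (canStart s (suc n + suc i))) _ _ (tightW s i *ℤ G (suc n)) _ ⟩
    bit (canStart s (suc n + suc i)) +ℤ ((tightW s i *ℤ G (suc n) +ℤ (dropS (suc i) (tightW s) ⊛ G) n)
      +ℤ (looseW s i *ℤ G′ (suc n) +ℤ (dropS (suc i) (looseW s) ⊛ G′) n))
      ≡⟨ cong₂ _+ℤ_ (cong (λ k → bit (canStart s k)) (ℕP.+-suc (suc n) i)) (cong₂ _+ℤ_ (unfold (tightW s) G) (unfold (looseW s) G′)) ⟩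
    bit (canStart s (suc (suc n) + i)) +ℤ ((dropS i (tightW s) ⊛ G) (suc n) +ℤ (dropS i (looseW s) ⊛ G′) (suc n)) ∎
    where
    open ≡-Reasoning
    unfold : ∀ f h → f i *ℤ h (suc n) +ℤ (dropS (suc i) f ⊛ h) n ≡ (dropS i f ⊛ h) (suc n)
    unfold f h = sym (trans (⊛-head (dropS i f) h n) (cong (f i *ℤ h (suc n) +ℤ_)
      (⊛-cong {g = h} (λ k → cong f (sym (ℕP.+-suc k i))) (λ _ → refl) n)))
    regroup : ∀ a b c x y → (a +ℤ (b +ℤ c)) +ℤ (x +ℤ y) ≡ a +ℤ ((x +ℤ b) +ℤ (y +ℤ c))
    regroup = +-*-Solver.solve 5 (λ a b c x y → (a :+ (b :+ c)) :+ (x :+ y) := a :+ ((x :+ b) :+ (y :+ c))) refl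
      where open +-*-Solver

  count-first : ∀ s n → count 0 s (suc n) ≡ bit (canStart s (suc n)) +ℤ ((tightW s ⊛ G) n +ℤ (looseW s ⊛ G′) n)
  count-first s n = trans (count-unroll n 0 s) (cong₂ _+ℤ_ (cong (λ k → bit (canStart s k)) (ℕP.+-identityʳ (suc n)))
    (cong₂ _+ℤ_ (⊛-cong {g = G} (λ k → cong (tightW s) (ℕP.+-identityʳ k)) (λ _ → refl) n)
                (⊛-cong {g = G′} (λ k → cong (looseW s) (ℕP.+-identityʳ k)) (λ _ → refl) n)))

  -- Recurrences

  u : ℕ
  u = d / c

  d<c*[1+u] : d < c * suc u
  d<c*[1+u] = subst₂ _<_ (sym (m≡m%n+[m/n]*n d c)) (ℕP.*-comm (suc u) c) (ℕP.+-monoˡ-< (u * c) (m%n<n d c))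

  ≤u⇒tight : ∀ {i} → i < u → c * suc i ≤ d * 1
  ≤u⇒tight {i} i<u = subst₂ _≤_ (ℕP.*-comm (suc i) c) (sym (ℕP.*-identityʳ d)) (ℕP.≤-trans (ℕP.*-monoˡ-≤ c i<u) (m/n*n≤m d c))

  -- From a single zero, `bl` keeps adding zeros as long as c(i+1) ≤ d, that is for i < u; so u is
  -- the first loose index.
  bl-≤u : ∀ i → i ≤ u → bl i ≡ (i , 0)
  bl-≤u zero    _   = refl
  bl-≤u (suc i) i<u rewrite bl-≤u i (ℕP.<⇒≤ i<u) | isLoose-elim (i , 0) (≤u⇒tight i<u) = refl

  hasOne-≤u : ∀ i → i ≤ u → hasOne i ≡ false
  hasOne-≤u i i≤u rewrite bl-≤u i i≤u = refl

  loose-u : loose u ≡ true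
  loose-u rewrite bl-≤u u ℕP.≤-refl = isLoose-intro (u , 0) (subst (_< c * suc u) (sym (ℕP.*-identityʳ d)) d<c*[1+u])

  loose-<u : ∀ i → i < u → loose i ≡ false
  loose-<u i i<u with loose i in eq
  ... | false = refl
  ... | true  = contradiction (trans (sym (hasOne-intro (suc i) 1≤ob)) (hasOne-≤u (suc i) i<u)) λ ()
    where
    1≤ob : 1 ≤ ob (suc i)
    1≤ob rewrite eq = s≤s z≤n

  hasOne->u : ∀ k → hasOne (suc (u + k)) ≡ true
  hasOne->u zero    = hasOne-intro (suc (u + 0)) 1≤ob
    where
    1≤ob : 1 ≤ ob (suc (u + 0))
    1≤ob rewrite ℕP.+-identityʳ u | loose-u = s≤s z≤n
  hasOne->u (suc k) rewrite ℕP.+-suc u k = hasOne-suc (suc (u + k)) (hasOne->u k)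

  Λ Κ : Series
  Λ i = bit (loose i)
  Κ i = bit (hasOne i)

  Κ-closed : Κ ≗ˢ X^ 1 ⊛ (X^ u ⊛ ones)
  Κ-closed zero    = cong bit (hasOne-≤u 0 z≤n)
  Κ-closed (suc i) = trans (aux (ℕP.<-≤-connex i u)) (sym (X⊛-suc (X^ u ⊛ ones) i))
    where
    aux : i < u ⊎ u ≤ i → Κ (suc i) ≡ (X^ u ⊛ ones) i
    aux (inj₁ i<u) = trans (cong bit (hasOne-≤u (suc i) i<u)) (sym (X^⊛-< u ones i<u))
    aux (inj₂ u≤i) rewrite sym (ℕP.m+[n∸m]≡n u≤i) = trans (cong bit (hasOne->u (i ∸ u))) (sym (X^⊛-+ u ones (i ∸ u)))

  -- The only loose block without a one is 0^(u+1).
  looseWithOne : ∀ i → bit (hasOne i ∧ loose i) ≡ (Λ ⊖ X^ u) i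
  looseWithOne i with ℕP.<-cmp i u
  ... | tri< lt _ _ rewrite hasOne-≤u i (ℕP.<⇒≤ lt) | loose-<u i lt | X^-≢ {u} {i} (λ eq → ℕP.<⇒≢ lt (sym eq)) = refl
  ... | tri≈ _ refl _ rewrite hasOne-≤u i ℕP.≤-refl | loose-u | X^-≡ {u} {i} refl = refl
  ... | tri> _ _ gt rewrite sym (ℕP.m+[n∸m]≡n gt) | hasOne->u (i ∸ suc u) | X^-≢ {u} {suc u + (i ∸ suc u)} (ℕP.<⇒≢ (s≤s (ℕP.m≤m+n u _))) = sym (ℤP.+-identityʳ _)

  tightWithOne : ∀ i → bit (hasOne i ∧ not (loose i)) ≡ (Κ ⊖ (Λ ⊖ X^ u)) i
  tightWithOne i = trans (split (hasOne i) (loose i)) (cong (λ z → Κ i +ℤ -ℤ z) (looseWithOne i))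
    where
    split : ∀ x y → bit (x ∧ not y) ≡ bit x +ℤ -ℤ bit (x ∧ y)
    split true  true  = refl
    split true  false = refl
    split false _     = refl

  -- Identification of the loose blocks with the series A

  g : ℕ → ℕ
  g i = i + (i * d) / c

  g-mono : ∀ {i j} → i ≤ j → g i ≤ g j
  g-mono i≤j = ℕP.+-mono-≤ i≤j (/-monoˡ-≤ c (ℕP.*-monoˡ-≤ d i≤j))

  g-strict : ∀ i → g i < g (suc i)
  g-strict i = s≤s (ℕP.+-monoʳ-≤ i (/-monoˡ-≤ c (ℕP.*-monoˡ-≤ d (ℕP.n≤1+n i))))

  A : Series
  A = X^ 1 ⊛ (X^ 1 ⊛ Λ)

  A-suc² : ∀ n → A (suc (suc n)) ≡ Λ n
  A-suc² n = trans (X⊛-suc (X^ 1 ⊛ Λ) (suc n)) (X⊛-suc Λ n)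

  A-≤1 : ∀ r → r ≤ 1 → A r ≡ + 0
  A-≤1 zero    _ = refl
  A-≤1 (suc zero) _ = X⊛-suc (X^ 1 ⊛ Λ) 0
  A-≤1 (suc (suc _)) (s≤s ())

  term : ℕ → Series
  term i = X^ (1 + i + (i * d) / c)

  module _ (n : ℕ) where
    g-ob-≤ : g (ob n) ≤ n
    g-ob-≤ = subst (g (ob n) ≤_) (trans (ℕP.+-comm (ob n) (za n)) (size n)) (ℕP.+-monoʳ-≤ (ob n) (ℕP.≤-pred
      (m<n*o⇒m/o<n (subst₂ _<_ (ℕP.*-comm d (ob n)) (ℕP.*-comm c (suc (za n))) (proj₁ (admissible n))))))

    za≤/ : (za n) ≤ (suc (ob n) * d) / c
    za≤/ = *≤⇒≤/ (za n) c _ (subst₂ _≤_ (ℕP.*-comm c (za n)) (ℕP.*-comm d (suc (ob n))) (proj₂ (admissible n)))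

    suc-ob+za : suc (ob n) + (za n) ≡ suc n
    suc-ob+za = cong suc (trans (ℕP.+-comm (ob n) (za n)) (size n))

    ≤g-ob+1 : suc n ≤ g (suc (ob n))
    ≤g-ob+1 = subst (_≤ g (suc (ob n))) suc-ob+za (ℕP.+-monoʳ-≤ (suc (ob n)) za≤/)

    -- Admissibility gives `za n` ≤ ⌊(`ob n` + 1)d/c⌋, and looseness is exactly equality here. In
    -- that case n + 1 = `g (suc (ob n))`.
    X^g : X^ (suc (g (suc (ob n)))) (suc (suc n)) ≡ Λ n
    X^g with loose n in eq
    ... | true  = X^-≡ (cong suc (ℕP.≤-antisym (subst (g (suc (ob n)) ≤_) suc-ob+za (ℕP.+-monoʳ-≤ (suc (ob n))
           (ℕP.≤-pred (m<n*o⇒m/o<n (subst₂ _<_ (ℕP.*-comm d (suc (ob n))) (ℕP.*-comm c (suc (za n))) (isLoose-true (bl n) eq)))))) ≤g-ob+1))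
    ... | false = X^-≢ λ e → ℕP.<⇒≢ (subst (_< g (suc (ob n))) suc-ob+za (ℕP.+-monoʳ-< (suc (ob n))
           (*≤⇒≤/ (suc (za n)) c _ (subst₂ _≤_ (ℕP.*-comm c (suc (za n))) (ℕP.*-comm d (suc (ob n))) (isLoose-false (bl n) eq)))))
           (sym (ℕP.suc-injective e))

    -- Since `g (ob n)` < n + 1 ≤ `g (suc (ob n))` and `g` is strictly increasing, only the term i =
    -- `ob n` + 1 can have exponent n + 2. Partial sums that end before it vanish at this exponent.
    sumS-≤ob : ∀ m → m ≤ (ob n) → sumS m term (suc (suc n)) ≡ + 0
    sumS-≤ob zero    _   = refl
    sumS-≤ob (suc m) m<ob = trans (cong₂ _+ℤ_ (sumS-≤ob m (ℕP.<⇒≤ m<ob))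
      (X^-≢ {suc (g (suc m))} λ e → ℕP.<⇒≢ (s≤s (ℕP.≤-trans (g-mono m<ob) g-ob-≤)) (ℕP.suc-injective e))) refl

    sumS->ob : ∀ m → (ob n) < m → sumS m term (suc (suc n)) ≡ Λ n
    sumS->ob (suc m) ob<1+m with ℕP.m≤n⇒m<n∨m≡n (ℕP.≤-pred ob<1+m)
    ... | inj₂ refl = trans (cong₂ _+ℤ_ (sumS-≤ob (ob n) ℕP.≤-refl) X^g) (ℤP.+-identityˡ _)
    ... | inj₁ ob<m  = trans (cong₂ _+ℤ_ (sumS->ob m ob<m)
      (X^-≢ {suc (g (suc m))} λ e → ℕP.<⇒≢ n+1<g (sym (ℕP.suc-injective e)))) (ℤP.+-identityʳ _)
      where
      n+1<g : suc n < g (suc m)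
      n+1<g = ℕP.≤-<-trans ≤g-ob+1 (ℕP.≤-<-trans (g-mono ob<m) (g-strict m))


  -- Removing d zeros and c ones subtracts c d from both sides of each inequality, so the smaller
  -- block is again admissible and equally loose. The c ones are there by hypothesis, and d c ≤ d
  -- `ob n` < c(`za n` + 1) provides the d zeros.
  Λ-periodic : ∀ n → c ≤ ob n → Λ n ≡ A (suc (suc n) ∸ (c + d)) × c + d ≤ suc (suc n)
  Λ-periodic n c≤b = trans (cong bit shift) (sym (trans (cong A index) (A-suc² (p′ + b′)))) , le
    where
    p′ b′ : ℕ
    p′ = za n ∸ d
    b′ = ob n ∸ c
    d≤p : d ≤ za n
    d≤p = ℕP.≤-pred (ℕP.*-cancelˡ-< c d (suc (za n)) (ℕP.≤-<-trans
            (subst (_≤ d * ob n) (ℕP.*-comm d c) (ℕP.*-monoʳ-≤ d c≤b)) (proj₁ (admissible n))))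
    za≡ : za n ≡ d + p′
    za≡ = sym (ℕP.m+[n∸m]≡n d≤p)
    ob≡ : ob n ≡ c + b′
    ob≡ = sym (ℕP.m+[n∸m]≡n c≤b)
    n≡ : n ≡ (c + d) + (p′ + b′)
    n≡ = trans (sym (size n)) (trans (cong₂ _+_ za≡ ob≡)
      (ℕSolver.+-*-Solver.solve 4 (λ c d p b → (d :+ p) :+ (c :+ b) := (c :+ d) :+ (p :+ b)) refl c d p′ b′))
      where open ℕSolver.+-*-Solver
    le : c + d ≤ suc (suc n)
    le = ℕP.m≤n⇒m≤1+n (ℕP.m≤n⇒m≤1+n (subst (c + d ≤_) (sym n≡) (ℕP.m≤m+n _ _)))
    index : suc (suc n) ∸ (c + d) ≡ suc (suc (p′ + b′))
    index = trans (cong (λ k → suc (suc k) ∸ (c + d)) n≡)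
      (trans (cong (_∸ (c + d)) (sym (trans (ℕP.+-suc (c + d) _) (cong suc (ℕP.+-suc (c + d) (p′ + b′))))))
             (ℕP.m+n∸m≡n (c + d) _))
    lift : ∀ x → d * (c + x) ≡ c * d + d * x
    lift x = trans (ℕP.*-distribˡ-+ d c x) (cong (_+ d * x) (ℕP.*-comm d c))
    c*suc-za : c * suc (za n) ≡ c * d + c * suc p′
    c*suc-za = trans (cong (c *_) (trans (cong suc za≡) (sym (ℕP.+-suc d p′)))) (ℕP.*-distribˡ-+ c d (suc p′))
    d*suc-ob : d * suc (ob n) ≡ c * d + d * suc b′
    d*suc-ob = trans (cong (d *_) (trans (cong suc ob≡) (sym (ℕP.+-suc c b′)))) (lift (suc b′))
    adm₁ : d * b′ < c * suc p′
    adm₁ = ℕP.+-cancelˡ-< (c * d) _ _ (subst₂ _<_ (trans (cong (d *_) ob≡) (lift b′))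
      c*suc-za (proj₁ (admissible n)))
    adm₂ : c * p′ ≤ d * suc b′
    adm₂ = ℕP.+-cancelˡ-≤ (c * d) _ _ (subst₂ _≤_ (trans (cong (c *_) za≡) (ℕP.*-distribˡ-+ c d p′))
      d*suc-ob (proj₂ (admissible n)))
    shift : loose n ≡ loose (p′ + b′)
    shift rewrite admissible-unique p′ b′ (adm₁ , adm₂) with loose n in eq
    ... | true  = sym (isLoose-intro (p′ , b′) (ℕP.+-cancelˡ-< (c * d) _ _ (subst₂ _<_ d*suc-ob c*suc-za (isLoose-true (bl n) eq))))
    ... | false = sym (isLoose-elim (p′ , b′) (ℕP.+-cancelˡ-≤ (c * d) _ _ (subst₂ _≤_ c*suc-za d*suc-ob (isLoose-false (bl n) eq))))

  g-c : g c ≡ c + d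
  g-c = cong (λ k → c + k) (trans (cong (_/ c) (ℕP.*-comm c d)) (m*n/n≡m d c))

  2≤c+d : 2 ≤ c + d
  2≤c+d = ℕP.+-mono-≤ 1≤c (ℕP.≤-trans 1≤c c≤d)

  X^⊛-∸ : ∀ e f k → e ≤ k → (X^ e ⊛ f) k ≡ f (k ∸ e)
  X^⊛-∸ e f k e≤k = trans (cong (X^ e ⊛ f) (sym (ℕP.m+[n∸m]≡n e≤k))) (X^⊛-+ e f (k ∸ e))

  Nc-rec : A ≗ˢ Nc c d ⊕ (X^ (c + d) ⊛ A)
  Nc-rec zero = sym (trans (cong₂ _+ℤ_ (low c) (X^⊛-< (c + d) A (ℕP.≤-trans (s≤s z≤n) 2≤c+d))) refl)
    where
    low : ∀ m → sumS m term 0 ≡ + 0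
    low zero    = refl
    low (suc m) = cong (_+ℤ + 0) (low m)
  Nc-rec (suc zero) = trans (A-≤1 1 ℕP.≤-refl) (sym (trans (cong₂ _+ℤ_ (low c) (X^⊛-< (c + d) A 2≤c+d)) refl))
    where
    low : ∀ m → sumS m term 1 ≡ + 0
    low zero    = refl
    low (suc m) = trans (cong₂ _+ℤ_ (low m) (X^-≢ {suc (g (suc m))} {1} λ ())) refl
  Nc-rec (suc (suc n)) = trans (A-suc² n) (sym (aux (ℕP.<-≤-connex (ob n) c)))
    where
    aux : ob n < c ⊎ c ≤ ob n → Nc c d (suc (suc n)) +ℤ (X^ (c + d) ⊛ A) (suc (suc n)) ≡ Λ n
    aux (inj₁ b<c) = trans (cong₂ _+ℤ_ (sumS->ob n c b<c) vanish) (ℤP.+-identityʳ _)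
      where
      vanish : (X^ (c + d) ⊛ A) (suc (suc n)) ≡ + 0
      vanish with ℕP.<-≤-connex (suc (suc n)) (c + d)
      ... | inj₁ lt = X^⊛-< (c + d) A lt
      -- From n + 1 ≤ `g (suc (ob n))` ≤ `g c` = c + d, the shifted index is at most 1, and `A`
      -- starts in degree 2.
      ... | inj₂ ge = trans (X^⊛-∸ (c + d) A _ ge) (A-≤1 _ (ℕP.m≤n+o⇒m∸n≤o _ (c + d)
          (subst (suc (suc n) ≤_) (ℕP.+-comm 1 (c + d)) (s≤s (subst (suc n ≤_) g-c (ℕP.≤-trans (≤g-ob+1 n) (g-mono b<c)))))))
    aux (inj₂ c≤b) = trans (cong₂ _+ℤ_ (sumS-≤ob n c c≤b)
       (trans (X^⊛-∸ (c + d) A _ (proj₂ (Λ-periodic n c≤b))) (sym (proj₁ (Λ-periodic n c≤b))))) (ℤP.+-identityˡ _)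

  J-rec : ones ≗ˢ constS (+ 1) ⊕ (X^ 1 ⊛ ones)
  J-rec zero    = refl
  J-rec (suc k) = sym (trans (ℤP.+-identityˡ _) (X⊛-suc ones k))

  later : Series
  later = ((X^ 1 ⊛ (X^ u ⊛ ones) ⊖ (Λ ⊖ X^ u)) ⊛ G) ⊕ ((Λ ⊖ X^ u) ⊛ G′)

  -- `ones` counts the single-block chains, one of each length. The factor x comes from the offset:
  -- a block of length i + 1 before a chain of length j + 1 has length i + j + 2, hence index i + j
  -- + 1.
  G-rec : G ≗ˢ ones ⊕ (X^ 1 ⊛ later)
  G-rec zero    = refl
  G-rec (suc n) = trans (count-first false n) (cong (+ 1 +ℤ_) (sym (trans (X⊛-suc later n) (cong₂ _+ℤ_
    (⊛-cong {g = G} (λ k → sym (trans (tightWithOne k) (cong (_+ℤ negS (Λ ⊖ X^ u) k) (Κ-closed k)))) (λ _ → refl) n)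
    (⊛-cong {g = G′} (λ k → sym (looseWithOne k)) (λ _ → refl) n)))))

  bit-tightStart : ∀ i → bit (tightStart i) ≡ (X^ 1 ⊛ Λ) i
  bit-tightStart zero    = refl
  bit-tightStart (suc i) = sym (X⊛-suc Λ i)

  tight-only : ∀ i → tightW true i ≡ bit (tightStart i) × looseW true i ≡ + 0
  tight-only i with tightStart i in eq
  ... | false = refl , refl
  ... | true rewrite tightStart⇒hasOne i eq | tightStart⇒¬loose i eq = refl , refl

  G′-rec : G′ ≗ˢ (X^ 1 ⊛ Λ) ⊕ (X^ 1 ⊛ ((X^ 1 ⊛ Λ) ⊛ G))
  G′-rec zero    = refl
  G′-rec (suc n) = trans (count-first true n) (cong₂ _+ℤ_ (bit-tightStart (suc n)) (trans (cong₂ _+ℤ_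
    (⊛-cong {g = G} (λ k → trans (proj₁ (tight-only k)) (bit-tightStart k)) (λ _ → refl) n)
    (trans (⊛-cong {g = G′} (λ k → proj₂ (tight-only k)) (λ _ → refl) n) (zero-⊛ G′ n)))
    (trans (ℤP.+-identityʳ (((X^ 1 ⊛ Λ) ⊛ G) n)) (sym (X⊛-suc ((X^ 1 ⊛ Λ) ⊛ G) n)))))

  W : Series
  W n = + length (chainWords n)

  W-rec : W ≗ˢ X^ 1 ⊛ (W ⊕ G)
  W-rec zero    = refl
  W-rec (suc n) = trans (cong +_ (trans (ListP.length-++ (map (true ∷_) (chainWords n))) (cong (_+ length (chains 0 false n)) (ListP.length-map (true ∷_) (chainWords n)))))
    (sym (X⊛-suc (W ⊕ G) n))

  -- `HasCard` brings its own list; duplicate-free lists with the same members are permutations of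
  -- each other, so it has the length of `chainWords`.
  genFun-W : ∀ m → (∀ n → 1 ≤ n → HasCard n (MeetIrr c d n) (m n)) → genFun m ≗ˢ W
  genFun-W m card zero = refl
  genFun-W m card (suc n) with card (suc n) (s≤s z≤n)
  ... | L , uniq , mem , len = cong +_ (trans (sym len) (trans (sym (ListP.length-map toList L))
          (↭-length (∼bag⇒↭ (unique∧set⇒bag (UniqueP.map⁺ toList-inj uniq) (chainWords-unique (suc n)) (mk⇔ to from))))))
    where
    to : ∀ {w} → w ∈ map toList L → w ∈ chainWords (suc n)
    to w∈ with ∈-map⁻ toList w∈
    ... | v , v∈ , refl with meetIrr⇒chain v (Equivalence.to (mem v) v∈)
    ... | e , x , i , eq , ch = subst (_∈ chainWords (suc n)) (sym eq) (chainWords-complete (suc n) e ch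
          (trans (cong length (sym eq)) (VecP.length-toList v)))
    from : ∀ {w} → w ∈ chainWords (suc n) → w ∈ map toList L
    from {w} w∈ with chainWords-sound (suc n) w∈
    ... | len , cw with word w len
    ... | v , refl = ∈-map⁺ toList (Equivalence.from (mem v) (chain⇒meetIrr v cw))

  X^2≗X⊛X : X^ 2 ≗ˢ X^ 1 ⊛ X^ 1
  X^2≗X⊛X = X^suc≗X⊛X^ 1

  X^[2+u]≗ : X^ (2 + u) ≗ˢ X^ 1 ⊛ (X^ 1 ⊛ X^ u)
  X^[2+u]≗ k = trans (X^suc≗X⊛X^ (suc u) k) (⊛-cong {f = X^ 1} (λ _ → refl) (X^suc≗X⊛X^ u) k)

  W⊛Den : W ⊛ Den c d ≗ˢ Num c d
  W⊛Den = quotient (X^ 1) (X^ u) (Tser c d) Λ ones G G′ W (Nc c d) (X^ 0) (xm1 c d) (X^ 2) (X^ (2 + u)) (X^ (3 + u)) (X^ (c + d))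
    X^0≗1 (λ _ → refl) X^2≗X⊛X X^[2+u]≗ (X^suc≗X⊛X^ (2 + u)) (λ _ → refl) J-rec G-rec G′-rec W-rec Nc-rec
    where open RationalForm seriesRing constS-morphism

mainTheorem12 : (c d : ℕ) → .{{_ : NonZero c}} → .{{_ : NonZero d}} → c ≤ d →
    (m : ℕ → ℕ) → (∀ n → 1 ≤ n → HasCard n (MeetIrr c d n) (m n)) →
    ∀ k → (genFun m ⊛ Den c d) k ≡ Num c d k
mainTheorem12 c d c≤d m card k =
  trans (⊛-cong {g = Den c d} (genFun-W m card) (λ _ → refl) k) (W⊛Den k)
  where open QDecreasing c d c≤d
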